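{- Fix $d\ge3$. For every $\varepsilon>0$ there is $C>0$ such that the following holds. Let $q$ be a prime power, $B$ a non-degenerate bilinear form on $\mathbb{F}_q^d$, and $\mathcal{A},\mathcal{B},\mathcal{C}\subseteq\mathbb{F}_q^d$ with $|\mathcal{A}||\mathcal{B}|,\ |\mathcal{A}||\mathcal{C}|,\ |\mathcal{B}||\mathcal{C}|\ge Cq^{d+2}$. Then the system \[ B(\mathbf{a},\mathbf{b})=\lambda_1,\quad B(\mathbf{a},\mathbf{c})=\lambda_2,\quad B(\mathbf{b},\mathbf{c})=\lambda_3,\qquad \mathbf{a}\in\mathcal{A},\ \mathbf{b}\in\mathcal{B},\ \mathbf{c}\in\mathcal{C}, \] is solvable for at least $(1-\varepsilon)q^3$ triples $(\lambda_1,\lambda_2,\lambda_3)\in(\mathbb{F}_q^*)^3$. (In asymptotic notation: it is solvable for $(1-o(1))q^3$ such triples.)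
   Context: $B:\mathbb{F}_q^d\times\mathbb{F}_q^d\to\mathbb{F}_q$ is bilinear and non-degenerate; $\mathbb{F}_q^*=\mathbb{F}_q\setminus\{0\}$. -}

module Defs where

open import Algebra.Structures using (IsCommutativeRing)
open import Data.Fin.Base using (Fin)
open import Data.Fin.Properties using () renaming (_≟_ to _≟ᶠ_)
open import Data.Integer.Base using (+_)
open import Data.List.Base using (List; []; _∷_; map; filter; length; allFin; cartesianProduct; cartesianProductWith)
open import Data.List.Membership.Propositional using (_∈_; lose; find)
open import Data.List.Membership.Propositional.Properties using (∈-map⁺; ∈-allFin; ∈-cartesianProduct⁺; ∈-cartesianProductWith⁺)
open import Data.List.Relation.Unary.All using ([])
open import Data.List.Relation.Unary.AllPairs using ([]; _∷_)
open import Data.List.Relation.Unary.Any using (here; any?)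
open import Data.List.Relation.Unary.Unique.Propositional using (Unique)
open import Data.List.Relation.Unary.Unique.Propositional.Properties using (map⁺; allFin⁺; cartesianProduct⁺; cartesianProductWith⁺)
open import Data.Nat.Base using (ℕ; zero; suc; _^_; _≤_)
open import Data.Nat.Primality using (Prime)
open import Data.Product.Base using (∃; _×_; _,_)
open import Data.Rational.Base using (ℚ; _/_)
open import Data.Vec.Base as Vec using (Vec; replicate; zipWith)
open import Data.Vec.Properties using (∷-injective)
open import Function.Bundles using (_↔_; Inverse)
open import Function.Properties.Inverse using (↔-sym; Inverse⇒Injection)
open import Level using (0ℓ)
open import Relation.Binary.Definitions using (DecidableEquality)
open import Relation.Binary.PropositionalEquality using (_≡_; _≢_; refl; sym; trans; cong; subst)
open import Relation.Nullary.Decidable using (Dec; map′; _×-dec_; ¬?; via-injection)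
open import Relation.Unary using (Pred; Decidable)

fromℕ : ℕ → ℚ
fromℕ n = + n / 1

IsPrimePower : ℕ → Set
IsPrimePower q = ∃ λ p → ∃ λ k → Prime p × 1 ≤ k × q ≡ p ^ k

record Listing (X : Set) : Set where
  field
    elements : List X
    unique   : Unique elements
    complete : ∀ x → x ∈ elements

open Listing

∣_∣⟨_⟩ : {X : Set} {P : Pred X 0ℓ} → Decidable P → Listing X → ℕ
∣ P? ∣⟨ L ⟩ = length (filter P? (elements L))

∃-dec : {X : Set} {P : Pred X 0ℓ} → Listing X → Decidable P → Dec (∃ P)
∃-dec L P? = map′
  (λ p → let x , _ , px = find p in x , px)
  (λ (x , px) → lose (complete L x) px)
  (any? P? (elements L))

×-listing : {X Y : Set} → Listing X → Listing Y → Listing (X × Y)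
×-listing L M = record
  { elements = cartesianProduct (elements L) (elements M)
  ; unique   = cartesianProduct⁺ (unique L) (unique M)
  ; complete = λ (x , y) → ∈-cartesianProduct⁺ (complete L x) (complete M y)
  }

Vec-listing : {X : Set} → Listing X → ∀ n → Listing (Vec X n)
Vec-listing L zero = record
  { elements = Vec.[] ∷ []
  ; unique   = [] ∷ []
  ; complete = λ { Vec.[] → here refl }
  }
Vec-listing L (suc n) = record
  { elements = cartesianProductWith Vec._∷_ (elements L) (elements M)
  ; unique   = cartesianProductWith⁺ Vec._∷_ ∷-injective (unique L) (unique M)
  ; complete = λ { (x Vec.∷ v) → ∈-cartesianProductWith⁺ Vec._∷_ (complete L x) (complete M v) }
  }
  where M = Vec-listing L n

-- Equality is propositional: a finite field can always be carried by Fin q,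
-- so setoid equality would add no further examples.
record FiniteField (q : ℕ) : Set₁ where
  infixl 6 _+_
  infixl 7 _*_
  field
    Carrier           : Set
    _+_ _*_           : Carrier → Carrier → Carrier
    -_                : Carrier → Carrier
    0# 1#             : Carrier
    isCommutativeRing : IsCommutativeRing _≡_ _+_ _*_ -_ 0# 1#
    0≢1               : 0# ≢ 1#
    inverse           : ∀ x → x ≢ 0# → ∃ λ y → x * y ≡ 1#
    enumeration       : Fin q ↔ Carrier

  _≟_ : DecidableEquality Carrier
  _≟_ = via-injection (Inverse⇒Injection (↔-sym enumeration)) _≟ᶠ_

  listing : Listing Carrier
  listing = record
    { elements = map to (allFin q)
    ; unique   = map⁺ to-injective (allFin⁺ q)
    ; complete = λ x → subst (_∈ map to (allFin q)) (strictlyInverseˡ x) (∈-map⁺ to (∈-allFin (from x)))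
    }
    where
    open Inverse enumeration
    to-injective : ∀ {i j} → to i ≡ to j → i ≡ j
    to-injective {i} {j} eq = trans (sym (strictlyInverseʳ i)) (trans (cong from eq) (strictlyInverseʳ j))

module _ {q : ℕ} (F : FiniteField q) (d : ℕ) where
  open FiniteField F

  Vector : Set
  Vector = Vec Carrier d

  0ᵛ : Vector
  0ᵛ = replicate d 0#

  infixl 6 _+ᵛ_
  _+ᵛ_ : Vector → Vector → Vector
  _+ᵛ_ = zipWith _+_

  infixl 7 _*ᵛ_
  _*ᵛ_ : Carrier → Vector → Vector
  c *ᵛ v = Vec.map (c *_) v

  vectors : Listing Vector
  vectors = Vec-listing listing d

  triples : Listing (Carrier × Carrier × Carrier)
  triples = ×-listing listing (×-listing listing listing)

  record IsBilinear (B : Vector → Vector → Carrier) : Set where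
    field
      +-linearˡ : ∀ u v w → B (u +ᵛ v) w ≡ B u w + B v w
      *-linearˡ : ∀ c u w → B (c *ᵛ u) w ≡ c * B u w
      +-linearʳ : ∀ u v w → B u (v +ᵛ w) ≡ B u v + B u w
      *-linearʳ : ∀ c u w → B u (c *ᵛ w) ≡ c * B u w

  record IsNonDegenerate (B : Vector → Vector → Carrier) : Set where
    field
      left  : ∀ u → (∀ w → B u w ≡ 0#) → u ≡ 0ᵛ
      right : ∀ w → (∀ u → B u w ≡ 0#) → w ≡ 0ᵛ

  module _ (B : Vector → Vector → Carrier) (𝒜 ℬ 𝒞 : Pred Vector 0ℓ) where

    Solvable : Pred (Carrier × Carrier × Carrier) 0ℓ
    Solvable (λ₁ , λ₂ , λ₃) =
      ∃ λ a → ∃ λ b → ∃ λ c →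
        (𝒜 a × ℬ b × 𝒞 c) × B a b ≡ λ₁ × B a c ≡ λ₂ × B b c ≡ λ₃

    NonZeroSolvable : Pred (Carrier × Carrier × Carrier) 0ℓ
    NonZeroSolvable (λ₁ , λ₂ , λ₃) =
      (λ₁ ≢ 0# × λ₂ ≢ 0# × λ₃ ≢ 0#) × Solvable (λ₁ , λ₂ , λ₃)

  module _ (B : Vector → Vector → Carrier) {𝒜 ℬ 𝒞 : Pred Vector 0ℓ}
           (𝒜? : Decidable 𝒜) (ℬ? : Decidable ℬ) (𝒞? : Decidable 𝒞) where

    solvable? : Decidable (Solvable B 𝒜 ℬ 𝒞)
    solvable? (λ₁ , λ₂ , λ₃) =
      ∃-dec vectors λ a → ∃-dec vectors λ b → ∃-dec vectors λ c →
        (𝒜? a ×-dec ℬ? b ×-dec 𝒞? c)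
        ×-dec (B a b ≟ λ₁) ×-dec (B a c ≟ λ₂) ×-dec (B b c ≟ λ₃)

    nonZeroSolvable? : Decidable (NonZeroSolvable B 𝒜 ℬ 𝒞)
    nonZeroSolvable? (λ₁ , λ₂ , λ₃) =
      (¬? (λ₁ ≟ 0#) ×-dec ¬? (λ₂ ≟ 0#) ×-dec ¬? (λ₃ ≟ 0#))
      ×-dec solvable? (λ₁ , λ₂ , λ₃)

  card : {P : Pred Vector 0ℓ} → Decidable P → ℕ
  card P? = ∣ P? ∣⟨ vectors ⟩

  #solvable : (B : Vector → Vector → Carrier) {𝒜 ℬ 𝒞 : Pred Vector 0ℓ} →
              Decidable 𝒜 → Decidable ℬ → Decidable 𝒞 → ℕ
  #solvable B 𝒜? ℬ? 𝒞? = ∣ nonZeroSolvable? B 𝒜? ℬ? 𝒞? ∣⟨ triples ⟩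

{-# OPTIONS --safe #-}
module Submission where

-- For a list U of vectors let n_l(y) be the number of x ∈ U with φ(x, y) = l. If q·#{y ∈ W : φ(x, y) = φ(x', y)} ≤ |W|
-- for distinct x, x' ∈ U, then expanding the square gives ∑_{y ∈ W} ∑_l (q n_l(y) − |U|)² ≤ q²|U||W|.
--
-- With W the whole space and φ(x, y) = B(y, x) this produces one a ∈ 𝒜 such that all fibres U = {b ∈ ℬ : B(a, b) = λ₁} and
-- Y = {c ∈ 𝒞 : B(a, c) = λ₂} have at least half their expected sizes |ℬ|/q and |𝒞|/q. With W = {c : B(a, c) = λ₂} and φ = B,
-- a value λ₃ not attained by B on U × Y contributes |U|² for every c ∈ Y, so at most 4q/C values are missed. The condition
-- λ₂ ≠ 0 keeps the collision bound true when b − b' is a multiple of a. Finally C is taken to be a power K^d, which forces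
-- K ≤ q and makes the triples with a zero coordinate negligible.

open import Defs
open import Data.Nat.Base using (ℕ)

-- Finite integer sums and indicator functions

module Sums where
  open import Data.Integer.Base
  open import Data.Integer.Properties
  open import Data.Integer.Tactic.RingSolver using (solve-∀)
  open import Data.List.Base using (List; []; _∷_; _++_; map; filter; length; cartesianProductWith)
  open import Data.List.Membership.Propositional using (_∈_)
  open import Data.List.Relation.Unary.All as All using (All; []; _∷_)
  open import Data.List.Relation.Unary.AllPairs using ([]; _∷_)
  open import Data.List.Relation.Unary.Any using (here; there)
  open import Data.List.Relation.Unary.Unique.Propositional using (Unique)
  open import Data.Nat.Base using (z≤n)
  open import Function.Base using (_∘_)
  open import Level using (0ℓ)
  open import Relation.Binary.Definitions using (DecidableEquality)
  open import Relation.Binary.PropositionalEquality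
  open import Relation.Nullary using (Dec; yes; no; ¬_; contradiction)
  open import Relation.Unary using (Pred; Decidable)

  private variable
    X Y Z : Set
    P Q : Set

  *-mono : ∀ {i j k} → 0ℤ ≤ k → i ≤ j → k * i ≤ k * j
  *-mono {k = k} 0≤k = *-monoˡ-≤-nonNeg k {{nonNegative 0≤k}}

  0≤* : ∀ {i j} → 0ℤ ≤ i → 0ℤ ≤ j → 0ℤ ≤ i * j
  0≤* {i} {j} 0≤i 0≤j = subst (_≤ i * j) (*-zeroʳ i) (*-mono {0ℤ} {j} 0≤i 0≤j)

  *-mono₂ : ∀ {i j k l} → 0ℤ ≤ i → 0ℤ ≤ l → i ≤ j → k ≤ l → i * k ≤ j * l
  *-mono₂ {i} {j} {k} {l} 0≤i 0≤l i≤j k≤l = ≤-trans (*-mono 0≤i k≤l) (subst₂ _≤_ (*-comm l i) (*-comm l j) (*-mono 0≤l i≤j))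

  0≤+ : ∀ {i j} → 0ℤ ≤ i → 0ℤ ≤ j → 0ℤ ≤ i + j
  0≤+ = +-mono-≤

  0≤pos : ∀ {n} → 0ℤ ≤ + n
  0≤pos = +≤+ z≤n

  0≤square : ∀ i → 0ℤ ≤ i * i
  0≤square (+ n)    = 0≤* {+ n} {+ n} 0≤pos 0≤pos
  0≤square -[1+ n ] = +≤+ z≤n

  -- Moving everything to one side reduces each linear inequality to a ring identity.
  ≤-from-diff : ∀ {i j} k → 0ℤ ≤ k → j - i ≡ k → i ≤ j
  ≤-from-diff k 0≤k eq = 0≤i-j⇒j≤i (subst (0ℤ ≤_) (sym eq) 0≤k)

  𝟙 : Dec P → ℤ
  𝟙 (yes _) = 1ℤ
  𝟙 (no _)  = 0ℤ

  0≤𝟙 : (p : Dec P) → 0ℤ ≤ 𝟙 p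
  0≤𝟙 (yes _) = 0≤pos
  0≤𝟙 (no _)  = 0≤pos

  𝟙≤1 : (p : Dec P) → 𝟙 p ≤ 1ℤ
  𝟙≤1 (yes _) = ≤-refl
  𝟙≤1 (no _)  = 0≤pos

  𝟙-mono : (p : Dec P) (r : Dec Q) → (P → Q) → 𝟙 p ≤ 𝟙 r
  𝟙-mono (yes p) (yes q) f = ≤-refl
  𝟙-mono (yes p) (no ¬q) f = contradiction (f p) ¬q
  𝟙-mono (no ¬p) r       f = 0≤𝟙 r

  𝟙-cong : (p : Dec P) (r : Dec Q) → (P → Q) → (Q → P) → 𝟙 p ≡ 𝟙 r
  𝟙-cong p r f g = ≤-antisym (𝟙-mono p r f) (𝟙-mono r p g)

  𝟙-yes : (p : Dec P) → P → 𝟙 p ≡ 1ℤ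
  𝟙-yes (yes _) _ = refl
  𝟙-yes (no ¬p) p = contradiction p ¬p

  𝟙-no : (p : Dec P) → ¬ P → 𝟙 p ≡ 0ℤ
  𝟙-no (yes p) ¬p = contradiction p ¬p
  𝟙-no (no _)  _  = refl

  ∑ : List X → (X → ℤ) → ℤ
  ∑ []       f = 0ℤ
  ∑ (x ∷ xs) f = f x + ∑ xs f

  ∑-cong : ∀ (xs : List X) {f g} → (∀ {x} → x ∈ xs → f x ≡ g x) → ∑ xs f ≡ ∑ xs g
  ∑-cong []       h = refl
  ∑-cong (x ∷ xs) h = cong₂ _+_ (h (here refl)) (∑-cong xs (h ∘ there))

  ∑-mono : ∀ (xs : List X) {f g} → (∀ {x} → x ∈ xs → f x ≤ g x) → ∑ xs f ≤ ∑ xs g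
  ∑-mono []       h = ≤-refl
  ∑-mono (x ∷ xs) h = +-mono-≤ (h (here refl)) (∑-mono xs (h ∘ there))

  0≤∑ : ∀ (xs : List X) {f} → (∀ x → 0ℤ ≤ f x) → 0ℤ ≤ ∑ xs f
  0≤∑ []       h = ≤-refl
  0≤∑ (x ∷ xs) h = 0≤+ (h x) (0≤∑ xs h)

  ∑-+ : ∀ (xs : List X) f g → ∑ xs (λ x → f x + g x) ≡ ∑ xs f + ∑ xs g
  ∑-+ []       f g = refl
  ∑-+ (x ∷ xs) f g = trans (cong (λ s → f x + g x + s) (∑-+ xs f g)) (lemma (f x) (g x) (∑ xs f) (∑ xs g))
    where
    lemma : ∀ a b c d → a + b + (c + d) ≡ a + c + (b + d)
    lemma = solve-∀

  ∑-* : ∀ (xs : List X) k f → ∑ xs (λ x → k * f x) ≡ k * ∑ xs f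
  ∑-* []       k f = sym (*-zeroʳ k)
  ∑-* (x ∷ xs) k f = trans (cong (λ s → k * f x + s) (∑-* xs k f)) (sym (*-distribˡ-+ k (f x) (∑ xs f)))

  ∑-const : ∀ (xs : List X) k → ∑ xs (λ _ → k) ≡ + length xs * k
  ∑-const []       k = refl
  ∑-const (x ∷ xs) k = trans (cong (λ s → k + s) (∑-const xs k)) (sym (suc-* (+ length xs) k))

  ∑-swap : ∀ (xs : List X) (ys : List Y) (f : X → Y → ℤ) → ∑ xs (λ x → ∑ ys (f x)) ≡ ∑ ys (λ y → ∑ xs (λ x → f x y))
  ∑-swap []       ys f = sym (trans (∑-const ys 0ℤ) (*-zeroʳ (+ length ys)))
  ∑-swap (x ∷ xs) ys f = trans (cong (λ s → ∑ ys (f x) + s) (∑-swap xs ys f)) (sym (∑-+ ys (f x) _))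

  ∑-++ : ∀ (xs ys : List X) f → ∑ (xs ++ ys) f ≡ ∑ xs f + ∑ ys f
  ∑-++ []       ys f = sym (+-identityˡ _)
  ∑-++ (x ∷ xs) ys f = trans (cong (λ s → f x + s) (∑-++ xs ys f)) (sym (+-assoc (f x) _ _))

  ∑-map : ∀ (g : X → Y) xs f → ∑ (map g xs) f ≡ ∑ xs (f ∘ g)
  ∑-map g []       f = refl
  ∑-map g (x ∷ xs) f = cong (λ s → f (g x) + s) (∑-map g xs f)

  ∑-product : ∀ (g : X → Y → Z) xs ys f →
              ∑ (cartesianProductWith g xs ys) f ≡ ∑ xs (λ x → ∑ ys (λ y → f (g x y)))
  ∑-product g []       ys f = refl
  ∑-product g (x ∷ xs) ys f = trans (∑-++ (map (g x) ys) _ f) (cong₂ _+_ (∑-map (g x) ys f) (∑-product g xs ys f))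

  module _ {P : Pred X 0ℓ} (P? : Decidable P) where

    ∑-filter : ∀ xs f → ∑ (filter P? xs) f ≡ ∑ xs (λ x → 𝟙 (P? x) * f x)
    ∑-filter []       f = refl
    ∑-filter (x ∷ xs) f with P? x
    ... | yes _ = cong₂ _+_ (sym (*-identityˡ (f x))) (∑-filter xs f)
    ... | no  _ = trans (∑-filter xs f) (sym (+-identityˡ _))

    length-filter : ∀ xs → + length (filter P? xs) ≡ ∑ xs (λ x → 𝟙 (P? x))
    length-filter xs = begin
      + length (filter P? xs)        ≡⟨ *-identityʳ _ ⟨
      + length (filter P? xs) * 1ℤ   ≡⟨ ∑-const (filter P? xs) 1ℤ ⟨
      ∑ (filter P? xs) (λ _ → 1ℤ)    ≡⟨ ∑-filter xs _ ⟩
      ∑ xs (λ x → 𝟙 (P? x) * 1ℤ)     ≡⟨ ∑-cong xs (λ _ → *-identityʳ _) ⟩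
      ∑ xs (λ x → 𝟙 (P? x))          ∎
      where open ≡-Reasoning

    ∑-filter-≤ : ∀ xs {f} → (∀ x → 0ℤ ≤ f x) → ∑ (filter P? xs) f ≤ ∑ xs f
    ∑-filter-≤ []       h = ≤-refl
    ∑-filter-≤ (x ∷ xs) {f} h with P? x
    ... | yes _ = +-monoʳ-≤ (f x) (∑-filter-≤ xs h)
    ... | no  _ = ≤-trans (∑-filter-≤ xs h) (i≤j+i _ (f x) {{nonNegative (h x)}})

  term≤∑ : ∀ {xs : List X} {f x} → (∀ x → 0ℤ ≤ f x) → x ∈ xs → f x ≤ ∑ xs f
  term≤∑ {xs = y ∷ xs} {f} h (here refl) = ≤-trans (i≤j+i (f y) (∑ xs f) {{nonNegative (0≤∑ xs h)}}) (≤-reflexive (+-comm (∑ xs f) (f y)))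
  term≤∑ {xs = y ∷ xs} {f} h (there x∈)  = ≤-trans (term≤∑ h x∈) (i≤j+i (∑ xs f) (f y) {{nonNegative (h y)}})

  module _ (_≟_ : DecidableEquality X) where

    ∑-δ-absent : ∀ {xs x} (f : X → ℤ) → All (x ≢_) xs → ∑ xs (λ y → 𝟙 (x ≟ y) * f y) ≡ 0ℤ
    ∑-δ-absent {xs} {x} f x∉ = begin
      ∑ xs (λ y → 𝟙 (x ≟ y) * f y)   ≡⟨ ∑-cong xs (λ {y} y∈ → cong (_* f y) (𝟙-no (x ≟ y) (All.lookup x∉ y∈))) ⟩
      ∑ xs (λ _ → 0ℤ)                ≡⟨ ∑-const xs 0ℤ ⟩
      + length xs * 0ℤ               ≡⟨ *-zeroʳ (+ length xs) ⟩
      0ℤ                             ∎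
      where open ≡-Reasoning

    -- `Unique` makes the first occurrence of `x` the only one, so every other term vanishes. This
    -- collapses the inner sum in all double counts below.
    ∑-δ : ∀ {xs x} (f : X → ℤ) → Unique xs → x ∈ xs → ∑ xs (λ y → 𝟙 (x ≟ y) * f y) ≡ f x
    ∑-δ {y ∷ xs} f (y∉ ∷ _) (here refl) = begin
      𝟙 (y ≟ y) * f y + ∑ xs (λ z → 𝟙 (y ≟ z) * f z)   ≡⟨ cong₂ _+_ (cong (_* f y) (𝟙-yes (y ≟ y) refl)) (∑-δ-absent f y∉) ⟩
      1ℤ * f y + 0ℤ                                    ≡⟨ lemma (f y) ⟩
      f y                                              ∎
      where
      open ≡-Reasoning
      lemma : ∀ a → 1ℤ * a + 0ℤ ≡ a
      lemma = solve-∀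
    ∑-δ {y ∷ xs} {x} f (y∉ ∷ u) (there x∈) = begin
      𝟙 (x ≟ y) * f y + ∑ xs (λ z → 𝟙 (x ≟ z) * f z)   ≡⟨ cong₂ _+_ (cong (_* f y) (𝟙-no (x ≟ y) λ x≡y → All.lookup y∉ x∈ (sym x≡y))) (∑-δ f u x∈) ⟩
      0ℤ * f y + f x                                   ≡⟨ lemma (f y) (f x) ⟩
      f x                                              ∎
      where
      open ≡-Reasoning
      lemma : ∀ a b → 0ℤ * a + b ≡ b
      lemma = solve-∀

    ∑-δ-1 : ∀ {xs x} → Unique xs → x ∈ xs → ∑ xs (λ y → 𝟙 (x ≟ y)) ≡ 1ℤ
    ∑-δ-1 {xs} {x} u x∈ = trans (∑-cong xs (λ _ → sym (*-identityʳ _))) (∑-δ (λ _ → 1ℤ) u x∈)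

-- Second-moment bound for the distribution of values

module Spread {q : ℕ} (F : FiniteField q) where
  open FiniteField F using (Carrier; _≟_; listing; enumeration)
  open import Data.Integer.Base
  open import Data.Integer.Properties hiding (_≟_)
  open import Data.Integer.Tactic.RingSolver using (solve-∀)
  open import Data.List.Base using (List; length; allFin)
  open import Data.List.Membership.Propositional using (_∈_)
  open import Data.List.Properties using (length-map; length-tabulate)
  open import Data.List.Relation.Unary.Unique.Propositional using (Unique)
  open import Function.Base using (id)
  open import Function.Bundles using (Inverse)
  open import Relation.Binary.Definitions using (DecidableEquality)
  open import Relation.Binary.PropositionalEquality
  open import Relation.Nullary using (yes; no)
  open Listing
  open Sums

  Λ : List Carrier
  Λ = elements listing

  Q : ℤ
  Q = + q

  length-Λ : length Λ ≡ q
  length-Λ = trans (length-map (Inverse.to enumeration) (allFin q)) (length-tabulate {n = q} id)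

  ∑Λ-const : ∀ k → ∑ Λ (λ _ → k) ≡ Q * k
  ∑Λ-const k = trans (∑-const Λ k) (cong (λ n → + n * k) length-Λ)

  module _ {X Y : Set} (U : List X) (φ : X → Y → Carrier) where

    private
      u : ℤ
      u = + length U

    hits : Y → Carrier → ℤ
    hits y l = ∑ U (λ x → 𝟙 (φ x y ≟ l))

    -- The squared deviation of the counts from their mean `u` / `Q`, summed over all values and
    -- scaled by `Q`² to stay in the integers.
    spread : Y → ℤ
    spread y = ∑ Λ (λ l → (Q * hits y l - u) * (Q * hits y l - u))

    0≤spread : ∀ y → 0ℤ ≤ spread y
    0≤spread y = 0≤∑ Λ (λ l → 0≤square (Q * hits y l - u))

    -- Each `x` takes exactly one value at `y`.
    ∑-hits : ∀ y → ∑ Λ (hits y) ≡ u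
    ∑-hits y = begin
      ∑ Λ (λ l → ∑ U (λ x → 𝟙 (φ x y ≟ l)))   ≡⟨ ∑-swap Λ U _ ⟩
      ∑ U (λ x → ∑ Λ (λ l → 𝟙 (φ x y ≟ l)))   ≡⟨ ∑-cong U (λ {x} _ → ∑-δ-1 _≟_ (unique listing) (complete listing (φ x y))) ⟩
      ∑ U (λ _ → 1ℤ)                          ≡⟨ ∑-const U 1ℤ ⟩
      u * 1ℤ                                  ≡⟨ *-identityʳ u ⟩
      u                                       ∎
      where open ≡-Reasoning

    -- Opening one of the two factors into indicators collapses the sum over `l` to `l` = `φ x y`.
    -- The result counts the pairs of elements of `U` that collide at `y`.
    ∑-hits² : ∀ y → ∑ Λ (λ l → hits y l * hits y l) ≡ ∑ U (λ x → hits y (φ x y))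
    ∑-hits² y = begin
      ∑ Λ (λ l → hits y l * hits y l)                    ≡⟨ ∑-cong Λ (λ {l} _ → sym (∑-* U (hits y l) (λ x → 𝟙 (φ x y ≟ l)))) ⟩
      ∑ Λ (λ l → ∑ U (λ x → hits y l * 𝟙 (φ x y ≟ l)))   ≡⟨ ∑-swap Λ U (λ l x → hits y l * 𝟙 (φ x y ≟ l)) ⟩
      ∑ U (λ x → ∑ Λ (λ l → hits y l * 𝟙 (φ x y ≟ l)))   ≡⟨ ∑-cong U (λ {x} _ → ∑-cong Λ (λ {l} _ → *-comm (hits y l) (𝟙 (φ x y ≟ l)))) ⟩
      ∑ U (λ x → ∑ Λ (λ l → 𝟙 (φ x y ≟ l) * hits y l))   ≡⟨ ∑-cong U (λ {x} _ → ∑-δ _≟_ (hits y) (unique listing) (complete listing (φ x y))) ⟩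
      ∑ U (λ x → hits y (φ x y))                         ∎
      where open ≡-Reasoning

    -- The cross term contributes -2`Q u`² by `∑-hits`, and the constant term `Q u`² because there
    -- are `Q` values.
    spread-collisions : ∀ y → spread y ≡ Q * (Q * ∑ U (λ x → hits y (φ x y))) + - (Q * (u * u))
    spread-collisions y = begin
      spread y
        ≡⟨ ∑-cong Λ (λ {l} _ → expand Q (hits y l) u) ⟩
      ∑ Λ (λ l → Q * Q * (hits y l * hits y l) + (- (+ 2 * Q * u) * hits y l + u * u))
        ≡⟨ ∑-+ Λ (λ l → Q * Q * (hits y l * hits y l)) (λ l → - (+ 2 * Q * u) * hits y l + u * u) ⟩
      ∑ Λ (λ l → Q * Q * (hits y l * hits y l)) + ∑ Λ (λ l → - (+ 2 * Q * u) * hits y l + u * u)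
        ≡⟨ cong₂ _+_ (∑-* Λ (Q * Q) (λ l → hits y l * hits y l)) (∑-+ Λ (λ l → - (+ 2 * Q * u) * hits y l) (λ _ → u * u)) ⟩
      Q * Q * ∑ Λ (λ l → hits y l * hits y l) + (∑ Λ (λ l → - (+ 2 * Q * u) * hits y l) + ∑ Λ (λ _ → u * u))
        ≡⟨ cong₂ (λ s t → Q * Q * s + t) (∑-hits² y) (cong₂ _+_ (trans (∑-* Λ (- (+ 2 * Q * u)) (hits y)) (cong (λ s → - (+ 2 * Q * u) * s) (∑-hits y))) (∑Λ-const (u * u))) ⟩
      Q * Q * H + (- (+ 2 * Q * u) * u + Q * (u * u))
        ≡⟨ collect Q H u ⟩
      Q * (Q * H) + - (Q * (u * u))
        ∎
      where
      open ≡-Reasoning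
      H = ∑ U (λ x → hits y (φ x y))
      expand : ∀ Q n u → (Q * n - u) * (Q * n - u) ≡ Q * Q * (n * n) + (- (+ 2 * Q * u) * n + u * u)
      expand = solve-∀
      collect : ∀ Q H u → Q * Q * H + (- (+ 2 * Q * u) * u + Q * (u * u)) ≡ Q * (Q * H) + - (Q * (u * u))
      collect = solve-∀

    module _ (_≟ˣ_ : DecidableEquality X) (U! : Unique U) (W : List Y) where

      private
        w : ℤ
        w = + length W

      -- The main term `u`²`w` of the collision count cancels against the subtracted squares, which
      -- leaves only the contribution of the diagonal pairs.
      ∑-spread : (∀ {x x'} → x ∈ U → x' ∈ U → x ≢ x' → Q * ∑ W (λ y → 𝟙 (φ x' y ≟ φ x y)) ≤ w) →
                 ∑ W spread ≤ Q * Q * (u * w)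
      ∑-spread few = begin
        ∑ W spread                                         ≡⟨ ∑-cong W (λ {y} _ → spread-collisions y) ⟩
        ∑ W (λ y → Q * (Q * H y) + - (Q * (u * u)))        ≡⟨ ∑-+ W (λ y → Q * (Q * H y)) (λ _ → - (Q * (u * u))) ⟩
        ∑ W (λ y → Q * (Q * H y)) + ∑ W (λ _ → - (Q * (u * u)))
          ≡⟨ cong₂ _+_ (trans (∑-* W Q (λ y → Q * H y)) (cong (Q *_) (∑-* W Q H))) (∑-const W (- (Q * (u * u)))) ⟩
        Q * (Q * ∑ W H) + w * - (Q * (u * u))              ≤⟨ +-monoˡ-≤ (w * - (Q * (u * u))) (*-mono {k = Q} 0≤pos collisions) ⟩
        Q * (u * (u * w + Q * w)) + w * - (Q * (u * u))    ≡⟨ cancel Q u w ⟩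
        Q * Q * (u * w)                                    ∎
        where
        open ≤-Reasoning
        H : Y → ℤ
        H y = ∑ U (λ x → hits y (φ x y))

        cancel : ∀ Q u w → Q * (u * (u * w + Q * w)) + w * - (Q * (u * u)) ≡ Q * Q * (u * w)
        cancel = solve-∀

        C : X → X → ℤ
        C x x' = ∑ W (λ y → 𝟙 (φ x' y ≟ φ x y))

        -- On the diagonal every point of `W` collides, hence the extra `Q * w`. Keeping `w` there
        -- as well is harmless slack that lets one formula be summed over all pairs.
        pair : ∀ {x x'} → x ∈ U → x' ∈ U → Q * C x x' ≤ w + 𝟙 (x ≟ˣ x') * (Q * w)
        pair {x} {x'} x∈ x'∈ with x ≟ˣ x'
        ... | no x≢x' = ≤-trans (few x∈ x'∈ x≢x') (≤-reflexive (lemma w Q))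
          where
          lemma : ∀ w Q → w ≡ w + 0ℤ * (Q * w)
          lemma = solve-∀
        ... | yes _ = begin
          Q * C x x'          ≤⟨ *-mono {k = Q} 0≤pos (∑-mono W (λ {y} _ → 𝟙≤1 (φ x' y ≟ φ x y))) ⟩
          Q * ∑ W (λ _ → 1ℤ)  ≡⟨ cong (Q *_) (∑-const W 1ℤ) ⟩
          Q * (w * 1ℤ)        ≤⟨ ≤-from-diff w 0≤pos (lemma w Q) ⟩
          w + 1ℤ * (Q * w)    ∎
          where
          lemma : ∀ w Q → w + 1ℤ * (Q * w) - Q * (w * 1ℤ) ≡ w
          lemma = solve-∀

        row : ∀ {x} → x ∈ U → Q * ∑ U (C x) ≤ u * w + Q * w
        row {x} x∈ = begin
          Q * ∑ U (C x)                                 ≡⟨ ∑-* U Q (C x) ⟨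
          ∑ U (λ x' → Q * C x x')                       ≤⟨ ∑-mono U (pair x∈) ⟩
          ∑ U (λ x' → w + 𝟙 (x ≟ˣ x') * (Q * w))        ≡⟨ ∑-+ U (λ _ → w) (λ x' → 𝟙 (x ≟ˣ x') * (Q * w)) ⟩
          ∑ U (λ _ → w) + ∑ U (λ x' → 𝟙 (x ≟ˣ x') * (Q * w))
            ≡⟨ cong₂ _+_ (∑-const U w) (∑-δ _≟ˣ_ (λ _ → Q * w) U! x∈) ⟩
          u * w + Q * w                                 ∎

        collisions : Q * ∑ W H ≤ u * (u * w + Q * w)
        collisions = begin
          Q * ∑ W H                                     ≡⟨ cong (Q *_) (∑-swap W U (λ y x → hits y (φ x y))) ⟩
          Q * ∑ U (λ x → ∑ W (λ y → hits y (φ x y)))    ≡⟨ cong (Q *_) (∑-cong U (λ {x} _ → ∑-swap W U (λ y x' → 𝟙 (φ x' y ≟ φ x y)))) ⟩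
          Q * ∑ U (λ x → ∑ U (C x))                     ≡⟨ ∑-* U Q (λ x → ∑ U (C x)) ⟨
          ∑ U (λ x → Q * ∑ U (C x))                     ≤⟨ ∑-mono U row ⟩
          ∑ U (λ _ → u * w + Q * w)                     ≡⟨ ∑-const U (u * w + Q * w) ⟩
          u * (u * w + Q * w)                           ∎

-- Linear functionals on a finite vector space and the sizes of their level sets

module Linear {q : ℕ} (F : FiniteField q) (d : ℕ) where
  private module 𝔽 = FiniteField F
  open 𝔽 using (Carrier; _≟_; listing; 0#; 1#)
  open import Algebra.Bundles using (CommutativeRing)
  open import Data.Integer.Base
  open import Data.Integer.Properties hiding (_≟_)
  open import Data.List.Base using (List; []; _∷_; map; length; cartesianProductWith)
  open import Data.List.Properties using (length-++; length-map)
  import Data.Nat.Base as ℕ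
  open import Data.Nat.Base using (ℕ; zero; suc)
  open import Data.Product.Base using (∃; _,_; proj₁; proj₂)
  open import Data.Unit.Base using (⊤; tt)
  open import Data.Vec.Base using (Vec; []; _∷_; replicate; zipWith) renaming (map to mapᵛ)
  open import Data.Vec.Properties using (≡-dec; ∷-injective)
  open import Level using (0ℓ)
  open import Relation.Binary.Definitions using (DecidableEquality)
  open import Relation.Binary.PropositionalEquality
  open import Relation.Nullary using (yes; no; ¬_; contradiction; decidable-stable)
  open import Relation.Nullary.Decidable using (_×-dec_; ¬?)
  open import Relation.Unary using (Pred; Decidable)
  open Listing
  open Sums
  open Spread F using (Λ; Q; ∑Λ-const; length-Λ)

  private
    R : CommutativeRing 0ℓ 0ℓ
    R = record { isCommutativeRing = 𝔽.isCommutativeRing }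
    module R = CommutativeRing R
  open import Algebra.Properties.Ring R.ring using (-1*x≈-x; x∙y⁻¹≈ε⇒x≈y)

  𝕍 : Set
  𝕍 = Vector F d

  V : List 𝕍
  V = elements (vectors F d)

  _≟ᵛ_ : DecidableEquality 𝕍
  _≟ᵛ_ = ≡-dec _≟_

  infixl 6 _⊕_ _⊖ᵛ_
  infixl 7 _⊙_
  _⊕_ : 𝕍 → 𝕍 → 𝕍
  _⊕_ = _+ᵛ_ F d

  _⊙_ : Carrier → 𝕍 → 𝕍
  _⊙_ = _*ᵛ_ F d

  -- Subtraction is a translation by a scalar multiple, so `shift` applies to it directly.
  _⊖ᵛ_ : 𝕍 → 𝕍 → 𝕍
  u ⊖ᵛ v = u ⊕ (𝔽.- 1#) ⊙ v

  length-product : ∀ {X Y Z : Set} (g : X → Y → Z) xs ys →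
                   length (cartesianProductWith g xs ys) ≡ length xs ℕ.* length ys
  length-product g []       ys = refl
  length-product g (x ∷ xs) ys = trans (length-++ (map (g x) ys)) (cong₂ ℕ._+_ (length-map (g x) ys) (length-product g xs ys))

  length-vectors : ∀ n → length (elements (Vec-listing listing n)) ≡ q ℕ.^ n
  length-vectors zero    = refl
  length-vectors (suc n) = trans (length-product _∷_ Λ _) (cong₂ ℕ._*_ length-Λ (length-vectors n))

  cancel-shift : ∀ c t x → c 𝔽.+ t 𝔽.* x 𝔽.+ (𝔽.- t) 𝔽.* x ≡ c
  cancel-shift c t x = begin
    c 𝔽.+ t 𝔽.* x 𝔽.+ (𝔽.- t) 𝔽.* x     ≡⟨ R.+-assoc c _ _ ⟩
    c 𝔽.+ (t 𝔽.* x 𝔽.+ (𝔽.- t) 𝔽.* x)   ≡⟨ cong (c 𝔽.+_) (R.distribʳ x t (𝔽.- t)) ⟨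
    c 𝔽.+ (t 𝔽.+ 𝔽.- t) 𝔽.* x           ≡⟨ cong (λ s → c 𝔽.+ s 𝔽.* x) (R.-‿inverseʳ t) ⟩
    c 𝔽.+ 0# 𝔽.* x                      ≡⟨ cong (c 𝔽.+_) (R.zeroˡ x) ⟩
    c 𝔽.+ 0#                            ≡⟨ R.+-identityʳ c ⟩
    c                                   ∎
    where open ≡-Reasoning

  -- Gives translations an inverse, which `∑-shift-≤` uses to bound the number of preimages.
  cancel-shiftᵛ : ∀ (c : 𝕍) t x → c ⊕ t ⊙ x ⊕ (𝔽.- t) ⊙ x ≡ c
  cancel-shiftᵛ = go
    where
    go : ∀ {n} (c : Vec Carrier n) t x → zipWith 𝔽._+_ (zipWith 𝔽._+_ c (mapᵛ (t 𝔽.*_) x)) (mapᵛ ((𝔽.- t) 𝔽.*_) x) ≡ c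
    go []      t []      = refl
    go (c ∷ v) t (x ∷ w) = cong₂ _∷_ (cancel-shift c t x) (go v t w)

  a-b≡0⇒a≡b : ∀ a b → a 𝔽.+ (𝔽.- 1#) 𝔽.* b ≡ 0# → a ≡ b
  a-b≡0⇒a≡b a b eq = x∙y⁻¹≈ε⇒x≈y a b (trans (cong (a 𝔽.+_) (sym (-1*x≈-x b))) eq)

  a≡b⇒a-b≡0 : ∀ {a b} → a ≡ b → a 𝔽.+ (𝔽.- 1#) 𝔽.* b ≡ 0#
  a≡b⇒a-b≡0 {a} refl = trans (cong (a 𝔽.+_) (-1*x≈-x a)) (R.-‿inverseʳ a)

  u⊖v≡0⇒u≡v : ∀ (u v : 𝕍) → u ⊖ᵛ v ≡ 0ᵛ F d → u ≡ v
  u⊖v≡0⇒u≡v = go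
    where
    go : ∀ {n} (u v : Vec Carrier n) → zipWith 𝔽._+_ u (mapᵛ ((𝔽.- 1#) 𝔽.*_) v) ≡ replicate n 0# → u ≡ v
    go []      []      eq = refl
    go (a ∷ u) (b ∷ v) eq = let eq₁ , eq₂ = ∷-injective eq in cong₂ _∷_ (a-b≡0⇒a≡b a b eq₁) (go u v eq₂)

  -- Abstracts from the slot of the form that varies, so that the level set bounds serve both `B u`
  -- and `λ u → B u w`.
  record IsLinear (f : 𝕍 → Carrier) : Set where
    field
      +-homo : ∀ u v → f (u ⊕ v) ≡ f u 𝔽.+ f v
      *-homo : ∀ c u → f (c ⊙ u) ≡ c 𝔽.* f u

    shift : ∀ c t x → f (c ⊕ t ⊙ x) ≡ f c 𝔽.+ t 𝔽.* f x
    shift c t x = trans (+-homo c (t ⊙ x)) (cong (f c 𝔽.+_) (*-homo t x))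

    shift-kernel : ∀ c t {x} → f x ≡ 0# → f (c ⊕ t ⊙ x) ≡ f c
    shift-kernel c t {x} fx≡0 = begin
      f (c ⊕ t ⊙ x)     ≡⟨ shift c t x ⟩
      f c 𝔽.+ t 𝔽.* f x ≡⟨ cong (λ s → f c 𝔽.+ t 𝔽.* s) fx≡0 ⟩
      f c 𝔽.+ t 𝔽.* 0#  ≡⟨ cong (f c 𝔽.+_) (R.zeroʳ t) ⟩
      f c 𝔽.+ 0#        ≡⟨ R.+-identityʳ (f c) ⟩
      f c               ∎
      where open ≡-Reasoning

    -- The multiplier is (`ν` - `μ`) / `f x`. It depends on the two values only, so a single
    -- translation moves the whole fibre.
    transport : ∀ {x} → f x ≢ 0# → ∀ μ ν → ∃ λ t → ∀ c → f c ≡ μ → f (c ⊕ t ⊙ x) ≡ ν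
    transport {x} fx≢0 μ ν = t 𝔽.* s , λ c fc≡μ → begin
      f (c ⊕ (t 𝔽.* s) ⊙ x)                ≡⟨ shift c (t 𝔽.* s) x ⟩
      f c 𝔽.+ t 𝔽.* s 𝔽.* f x              ≡⟨ cong₂ 𝔽._+_ fc≡μ (R.*-assoc t s (f x)) ⟩
      μ 𝔽.+ t 𝔽.* (s 𝔽.* f x)              ≡⟨ cong (λ r → μ 𝔽.+ t 𝔽.* r) (trans (R.*-comm s (f x)) fx*s≡1) ⟩
      μ 𝔽.+ t 𝔽.* 1#                       ≡⟨ cong (μ 𝔽.+_) (R.*-identityʳ t) ⟩
      μ 𝔽.+ ((𝔽.- μ) 𝔽.+ ν)                ≡⟨ R.+-assoc μ _ ν ⟨
      μ 𝔽.+ (𝔽.- μ) 𝔽.+ ν                  ≡⟨ cong (𝔽._+ ν) (R.-‿inverseʳ μ) ⟩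
      0# 𝔽.+ ν                             ≡⟨ R.+-identityˡ ν ⟩
      ν                                    ∎
      where
      open ≡-Reasoning
      t = (𝔽.- μ) 𝔽.+ ν
      s = proj₁ (𝔽.inverse (f x) fx≢0)
      fx*s≡1 = proj₂ (𝔽.inverse (f x) fx≢0)

  -- Sum over pairs `c`, `c'` with `g c` = `c'`. The inverse translation `h` recovers `c` from `c'`,
  -- so each value `f c'` is used at most once.
  ∑-shift-≤ : ∀ t x {f : 𝕍 → ℤ} → (∀ c → 0ℤ ≤ f c) → ∑ V (λ c → f (c ⊕ t ⊙ x)) ≤ ∑ V f
  ∑-shift-≤ t x {f} 0≤f = begin
    ∑ V (λ c → f (g c))
      ≡⟨ ∑-cong V (λ {c} _ → ∑-δ _≟ᵛ_ f V! (complete (vectors F d) (g c))) ⟨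
    ∑ V (λ c → ∑ V (λ c' → 𝟙 (g c ≟ᵛ c') * f c'))
      ≡⟨ ∑-swap V V (λ c c' → 𝟙 (g c ≟ᵛ c') * f c') ⟩
    ∑ V (λ c' → ∑ V (λ c → 𝟙 (g c ≟ᵛ c') * f c'))
      ≤⟨ ∑-mono V (λ {c'} _ → ∑-mono V (λ {c} _ → *-monoʳ-≤-nonNeg (f c') {{nonNegative (0≤f c')}} (𝟙-mono (g c ≟ᵛ c') (h c' ≟ᵛ c) (inv c c')))) ⟩
    ∑ V (λ c' → ∑ V (λ c → 𝟙 (h c' ≟ᵛ c) * f c'))
      ≡⟨ ∑-cong V (λ {c'} _ → ∑-δ _≟ᵛ_ (λ _ → f c') V! (complete (vectors F d) (h c'))) ⟩
    ∑ V f
      ∎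
    where
    open ≤-Reasoning
    V! = unique (vectors F d)
    g h : 𝕍 → 𝕍
    g c = c ⊕ t ⊙ x
    h c = c ⊕ (𝔽.- t) ⊙ x
    inv : ∀ c c' → g c ≡ c' → h c' ≡ c
    inv c _ refl = cancel-shiftᵛ c t x

  module _ {f : 𝕍 → Carrier} (lin : IsLinear f) where
    open IsLinear lin

    -- Translating along x moves the fibre over μ into every other fibre, so it is at most the average one.
    fibre-≤ : {P : Pred 𝕍 0ℓ} (P? : Decidable P) → ∀ {x} → f x ≢ 0# → (∀ c t → P c → P (c ⊕ t ⊙ x)) →
              ∀ μ → Q * ∑ V (λ c → 𝟙 (P? c) * 𝟙 (f c ≟ μ)) ≤ ∑ V (λ c → 𝟙 (P? c))
    fibre-≤ P? {x} fx≢0 P-shift μ = begin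
      Q * fibre μ                                              ≡⟨ ∑Λ-const (fibre μ) ⟨
      ∑ Λ (λ _ → fibre μ)                                      ≤⟨ ∑-mono Λ (λ {ν} _ → move ν) ⟩
      ∑ Λ fibre                                                ≡⟨ ∑-swap Λ V (λ ν c → 𝟙 (P? c) * 𝟙 (f c ≟ ν)) ⟩
      ∑ V (λ c → ∑ Λ (λ ν → 𝟙 (P? c) * 𝟙 (f c ≟ ν)))           ≡⟨ ∑-cong V (λ {c} _ → total c) ⟩
      ∑ V (λ c → 𝟙 (P? c))                                     ∎
      where
      open ≤-Reasoning
      fibre : Carrier → ℤ
      fibre ν = ∑ V (λ c → 𝟙 (P? c) * 𝟙 (f c ≟ ν))

      total : ∀ c → ∑ Λ (λ ν → 𝟙 (P? c) * 𝟙 (f c ≟ ν)) ≡ 𝟙 (P? c)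
      total c = trans (∑-* Λ (𝟙 (P? c)) (λ ν → 𝟙 (f c ≟ ν)))
                      (trans (cong (𝟙 (P? c) *_) (∑-δ-1 _≟_ (unique listing) (complete listing (f c)))) (*-identityʳ (𝟙 (P? c))))

      move : ∀ ν → fibre μ ≤ fibre ν
      move ν = let t , moves = transport fx≢0 μ ν in ≤-trans
        (∑-mono V (λ {c} _ → *-mono₂ (0≤𝟙 (P? c)) (0≤𝟙 (f (c ⊕ t ⊙ x) ≟ ν))
          (𝟙-mono (P? c) (P? (c ⊕ t ⊙ x)) (P-shift c t))
          (𝟙-mono (f c ≟ μ) (f (c ⊕ t ⊙ x) ≟ ν) (moves c))))
        (∑-shift-≤ t x (λ c → 0≤* (0≤𝟙 (P? c)) (0≤𝟙 (f c ≟ ν))))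

    -- The case of `fibre-≤` for the always true predicate, which every translation preserves.
    level-≤ : ∀ {x} → f x ≢ 0# → ∀ μ → Q * ∑ V (λ c → 𝟙 (f c ≟ μ)) ≤ + length V
    level-≤ fx≢0 μ = begin
      Q * ∑ V (λ c → 𝟙 (f c ≟ μ))        ≡⟨ cong (Q *_) (∑-cong V (λ {c} _ → sym (*-identityˡ (𝟙 (f c ≟ μ))))) ⟩
      Q * ∑ V (λ c → 1ℤ * 𝟙 (f c ≟ μ))   ≤⟨ fibre-≤ {P = λ _ → ⊤} (λ _ → yes tt) fx≢0 (λ _ _ _ → tt) μ ⟩
      ∑ V (λ _ → 1ℤ)                     ≡⟨ ∑-const V 1ℤ ⟩
      + length V * 1ℤ                    ≡⟨ *-identityʳ _ ⟩
      + length V                         ∎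
      where open ≤-Reasoning

  -- If f and g are proportional, then {f = l} and {g = 0} are disjoint because l ≢ 0.
  section-≤ : ∀ {f g} → IsLinear f → IsLinear g → ∀ {y} → g y ≢ 0# → ∀ {l} → l ≢ 0# →
              Q * ∑ V (λ c → 𝟙 (f c ≟ l) * 𝟙 (g c ≟ 0#)) ≤ ∑ V (λ c → 𝟙 (f c ≟ l))
  section-≤ {f} {g} f-lin g-lin {y} gy≢0 {l} l≢0
    with ∃-dec (vectors F d) (λ x → (f x ≟ 0#) ×-dec ¬? (g x ≟ 0#))
  -- Translating along this `x` stays inside {`f` = `l`} and changes `g`, so the zero set of `g` is
  -- an at most average fibre there.
  ... | yes (x , fx≡0 , gx≢0) =
    fibre-≤ g-lin (λ c → f c ≟ l) gx≢0 (λ c t fc≡l → trans (IsLinear.shift-kernel f-lin c t fx≡0) fc≡l) 0#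
  ... | no ∄x = begin
    Q * ∑ V (λ c → 𝟙 (f c ≟ l) * 𝟙 (g c ≟ 0#))   ≡⟨ cong (Q *_) (∑-cong V (λ {c} _ → disjoint c)) ⟩
    Q * ∑ V (λ _ → 0ℤ)                           ≡⟨ cong (Q *_) (trans (∑-const V 0ℤ) (*-zeroʳ (+ length V))) ⟩
    Q * 0ℤ                                       ≡⟨ *-zeroʳ Q ⟩
    0ℤ                                           ≤⟨ 0≤∑ V (λ c → 0≤𝟙 (f c ≟ l)) ⟩
    ∑ V (λ c → 𝟙 (f c ≟ l))                      ∎
    where
    open ≤-Reasoning
    disjoint : ∀ c → 𝟙 (f c ≟ l) * 𝟙 (g c ≟ 0#) ≡ 0ℤ
    disjoint c with f c ≟ l | g c ≟ 0#
    ... | no _     | no _     = refl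
    ... | no _     | yes _    = refl
    ... | yes _    | no _     = refl
    -- A common point `c` has `f c` nonzero, so some multiple of it added to `y` kills `f`. Since
    -- `g c` is zero, `g` keeps its nonzero value at `y`, and the result is the vector excluded by
    -- `∄x`.
    ... | yes fc≡l | yes gc≡0 =
      let t , moves = IsLinear.transport f-lin {c} (λ fc≡0 → l≢0 (trans (sym fc≡l) fc≡0)) (f y) 0#
      in contradiction
           (y ⊕ t ⊙ c , moves y refl , λ eq → gy≢0 (trans (sym (IsLinear.shift-kernel g-lin y t gc≡0)) eq))
           ∄x

  -- The functionals of a non-degenerate bilinear form

  module _ (B : 𝕍 → 𝕍 → Carrier) (bil : IsBilinear F d B) where
    open IsBilinear bil

    linearʳ : ∀ u → IsLinear (B u)
    linearʳ u = record { +-homo = +-linearʳ u ; *-homo = λ c → *-linearʳ c u }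

    linearˡ : ∀ w → IsLinear (λ u → B u w)
    linearˡ w = record { +-homo = λ u v → +-linearˡ u v w ; *-homo = λ c u → *-linearˡ c u w }

    module _ (nd : IsNonDegenerate F d B) where
      open IsNonDegenerate nd

      private
        -- A search through the finitely many vectors turns the negated universal statement into a
        -- witness.
        nonzero : (f : 𝕍 → Carrier) → ¬ (∀ x → f x ≡ 0#) → ∃ λ x → f x ≢ 0#
        nonzero f f≢0 with ∃-dec (vectors F d) (λ x → ¬? (f x ≟ 0#))
        ... | yes x = x
        ... | no ∄x = contradiction (λ x → decidable-stable (f x ≟ 0#) (λ fx≢0 → ∄x (x , fx≢0))) f≢0

      -- Non-degeneracy in contrapositive form. It provides the point of nonzero value that
      -- `section-≤` asks for; `separateʳ` does the same for `level-≤`.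
      separateˡ : ∀ {u v} → u ≢ v → ∃ λ x → B (u ⊖ᵛ v) x ≢ 0#
      separateˡ {u} {v} u≢v = nonzero (B (u ⊖ᵛ v)) (λ z → u≢v (u⊖v≡0⇒u≡v u v (left (u ⊖ᵛ v) z)))

      separateʳ : ∀ {u v} → u ≢ v → ∃ λ x → B x (u ⊖ᵛ v) ≢ 0#
      separateʳ {u} {v} u≢v = nonzero (λ x → B x (u ⊖ᵛ v)) (λ z → u≢v (u⊖v≡0⇒u≡v u v (right (u ⊖ᵛ v) z)))

    -- Rewrites a collision of two functionals as a zero of their difference, the form in which the
    -- level set bounds apply.
    𝟙-differenceˡ : ∀ u v x → 𝟙 (B u x ≟ B v x) ≡ 𝟙 (B (u ⊖ᵛ v) x ≟ 0#)
    𝟙-differenceˡ u v x = 𝟙-cong (B u x ≟ B v x) (B (u ⊖ᵛ v) x ≟ 0#)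
      (λ eq → trans expand (a≡b⇒a-b≡0 eq)) (λ eq → a-b≡0⇒a≡b _ _ (trans (sym expand) eq))
      where expand = IsLinear.shift (linearˡ x) u (𝔽.- 1#) v

    𝟙-differenceʳ : ∀ u v x → 𝟙 (B x u ≟ B x v) ≡ 𝟙 (B x (u ⊖ᵛ v) ≟ 0#)
    𝟙-differenceʳ u v x = 𝟙-cong (B x u ≟ B x v) (B x (u ⊖ᵛ v) ≟ 0#)
      (λ eq → trans expand (a≡b⇒a-b≡0 eq)) (λ eq → a-b≡0⇒a≡b _ _ (trans (sym expand) eq))
      where expand = IsLinear.shift (linearʳ x) u (𝔽.- 1#) v

-- Counting solvable triples over the integers

module Counting {q : ℕ} (F : FiniteField q) (d : ℕ)
                (B : Vector F d → Vector F d → FiniteField.Carrier F)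
                (bil : IsBilinear F d B) (nd : IsNonDegenerate F d B) where
  open FiniteField F using (Carrier; _≟_; listing; 0#; enumeration)
  open import Data.Fin.Base using (Fin)
  open import Data.Integer.Base
  open import Data.Integer.Properties hiding (_≟_)
  open import Data.Integer.Tactic.RingSolver using (solve-∀)
  open import Data.List.Base using (List; []; _∷_; filter; length; cartesianProduct)
  open import Data.List.Membership.Propositional using (_∈_; lose; find)
  open import Data.List.Membership.Propositional.Properties using (∈-filter⁻)
  open import Data.List.Relation.Unary.Any using (Any; any?; here)
  open import Data.List.Relation.Unary.Unique.Propositional.Properties using (filter⁺)
  import Data.Nat.Base as ℕ
  import Data.Nat.Properties as ℕ
  open import Data.Product.Base using (∃; _×_; _,_; proj₁; proj₂)
  open import Data.Sum.Base using (_⊎_; inj₁; inj₂; [_,_]′)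
  open import Function.Bundles using (Inverse)
  open import Level using (0ℓ)
  open import Relation.Binary.PropositionalEquality
  open import Relation.Nullary using (Dec; yes; no; ¬_; contradiction)
  open import Relation.Nullary.Decidable using (_×-dec_; ¬?)
  open import Relation.Unary using (Pred; Decidable)
  open Listing
  open Sums
  open Spread F
  open Linear F d

  0<* : ∀ {i j} → 0ℤ < i → 0ℤ < j → 0ℤ < i * j
  0<* {i} {j} 0<i 0<j = subst (_< i * j) (*-zeroʳ i) (*-monoˡ-<-pos i {{positive 0<i}} 0<j)

  0<factorʳ : ∀ i n → 0ℤ < i * + n → 0ℤ < + n
  0<factorʳ i ℕ.zero    0<in = contradiction (sym (*-zeroʳ i)) (<⇒≢ 0<in)
  0<factorʳ i (ℕ.suc n) _    = +<+ ℕ.z<s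

  9i≤8i⇒i≤0 : ∀ i → + 9 * i ≤ + 8 * i → i ≤ 0ℤ
  9i≤8i⇒i≤0 i 9i≤8i = ≤-from-diff (+ 8 * i - + 9 * i) (i≤j⇒0≤j-i 9i≤8i) (lemma i)
    where
    lemma : ∀ i → 0ℤ - i ≡ + 8 * i - + 9 * i
    lemma = solve-∀

  ¬×¬ : ∀ {P Q : Set} → Dec P → (P → ¬ Q) → ¬ P ⊎ ¬ Q
  ¬×¬ (yes p) ¬pq = inj₂ (¬pq p)
  ¬×¬ (no ¬p) ¬pq = inj₁ ¬p

  inhabited : ∀ {X : Set} (xs : List X) → 0ℤ < + length xs → ∃ (_∈ xs)
  inhabited []       (+<+ ())
  inhabited (x ∷ xs) _        = x , here refl

  n : ℤ
  n = + length V

  -- This is q^(`d` + 2), the scale of the density hypotheses, in the shape in which the spread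
  -- bounds produce it.
  T : ℤ
  T = Q * Q * n

  0<Q : 0ℤ < Q
  0<Q = lemma (Inverse.from enumeration 0#)
    where
    lemma : ∀ {m} → Fin m → 0ℤ < + m
    lemma {ℕ.suc m} _ = +<+ ℕ.z<s

  0<n : 0ℤ < n
  0<n = lemma V (complete (vectors F d) (0ᵛ F d))
    where
    lemma : ∀ {X : Set} {x} (xs : List X) → x ∈ xs → 0ℤ < + length xs
    lemma (x ∷ xs) _ = +<+ ℕ.z<s

  0<T : 0ℤ < T
  0<T = 0<* (0<* 0<Q 0<Q) 0<n

  -- Makes the first argument of `B` the point at which the spread is taken, while the list runs
  -- through the second argument.
  flip-B : 𝕍 → 𝕍 → Carrier
  flip-B x y = B y x

  module _ {P : Pred 𝕍 0ℓ} (P? : Decidable P) where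

    private
      U : List 𝕍
      U = filter P? V

    -- Distinct `x` and `x'` collide exactly on the zero set of a nonzero functional, which
    -- `level-≤` bounds by `n` / `Q`.
    ∑-spread-all : ∑ V (spread U flip-B) ≤ Q * Q * (+ length U * n)
    ∑-spread-all = ∑-spread U flip-B _≟ᵛ_ (filter⁺ P? (unique (vectors F d))) V few
      where
      open ≤-Reasoning
      few : ∀ {x x'} → x ∈ U → x' ∈ U → x ≢ x' → Q * ∑ V (λ y → 𝟙 (B y x' ≟ B y x)) ≤ n
      few {x} {x'} _ _ x≢x' = begin
        Q * ∑ V (λ y → 𝟙 (B y x' ≟ B y x))        ≡⟨ cong (Q *_) (∑-cong V (λ {y} _ → 𝟙-differenceʳ B bil x' x y)) ⟩
        Q * ∑ V (λ y → 𝟙 (B y (x' ⊖ᵛ x) ≟ 0#))    ≤⟨ level-≤ (linearˡ B bil (x' ⊖ᵛ x)) (proj₂ (separateʳ B bil nd (λ eq → x≢x' (sym eq)))) 0# ⟩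
        n                                         ∎

    -- The factor 4 makes every single deviation of `Q * hits` from the length of `U` smaller than
    -- half that length.
    Balanced : 𝕍 → Set
    Balanced a = + 4 * spread U flip-B a < + length U * + length U

    balanced? : Decidable Balanced
    balanced? a = + 4 * spread U flip-B a <? + length U * + length U

    balanced-hits : ∀ {a} → Balanced a → ∀ l → + length U ≤ + 2 * (Q * hits U flip-B a l)
    balanced-hits {a} bal l = [ (λ β≤2x → β≤2x) , (λ 2x≤β → contradiction bal (≤⇒≯ (bound 2x≤β))) ]′ (≤-total β (+ 2 * x))
      where
      open ≤-Reasoning
      β = + length U
      x = Q * hits U flip-B a l
      -- A difference of squares, (2`β` - 2`x`)² - `β`² = (`β` - 2`x`)(3`β` - 2`x`), with 3`β` -
      -- 2`x` split so that both summands are visibly nonnegative.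
      factor : ∀ x β → + 4 * ((x - β) * (x - β)) - β * β ≡ (β - + 2 * x) * (β - + 2 * x + + 2 * β)
      factor = solve-∀
      bound : + 2 * x ≤ β → β * β ≤ + 4 * spread U flip-B a
      bound 2x≤β = begin
        β * β                          ≤⟨ ≤-from-diff ((β - + 2 * x) * (β - + 2 * x + + 2 * β)) nonneg (factor x β) ⟩
        + 4 * ((x - β) * (x - β))      ≤⟨ *-mono {k = + 4} 0≤pos (term≤∑ (λ l → 0≤square (Q * hits U flip-B a l - β)) (complete listing l)) ⟩
        + 4 * spread U flip-B a        ∎
        where
        0≤β-2x : 0ℤ ≤ β - + 2 * x
        0≤β-2x = i≤j⇒0≤j-i 2x≤β
        nonneg : 0ℤ ≤ (β - + 2 * x) * (β - + 2 * x + + 2 * β)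
        nonneg = 0≤* 0≤β-2x (0≤+ 0≤β-2x (0≤* {+ 2} {β} 0≤pos 0≤pos))

  module _ {𝒜 ℬ 𝒞 : Pred 𝕍 0ℓ} (𝒜? : Decidable 𝒜) (ℬ? : Decidable ℬ) (𝒞? : Decidable 𝒞) where

    α β γ : ℤ
    α = + card F d 𝒜?
    β = + card F d ℬ?
    γ = + card F d 𝒞?

    -- Otherwise summing spreads over 𝒜 would give 9αβ²γ² ≤ 8αβ²γ².
    balanced-point : 0ℤ < α → 0ℤ < β → 0ℤ < γ → + 9 * T ≤ α * β → + 9 * T ≤ α * γ →
                     ∃ λ a → 𝒜 a × Balanced ℬ? a × Balanced 𝒞? a
    balanced-point 0<α 0<β 0<γ 9T≤αβ 9T≤αγ = decide (any? (λ a → balanced? ℬ? a ×-dec balanced? 𝒞? a) A)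
      where
      open ≤-Reasoning
      A = filter 𝒜? V
      Sβ Sγ : 𝕍 → ℤ
      Sβ = spread (filter ℬ? V) flip-B
      Sγ = spread (filter 𝒞? V) flip-B
      X = α * (β * β * (γ * γ))

      0<X : 0ℤ < X
      0<X = 0<* {α} {β * β * (γ * γ)} 0<α (0<* {β * β} {γ * γ} (0<* {β} {β} 0<β 0<β) (0<* {γ} {γ} 0<γ 0<γ))

      0≤γγSβ : ∀ a → 0ℤ ≤ γ * γ * Sβ a
      0≤γγSβ a = 0≤* (0≤square γ) (0≤spread (filter ℬ? V) flip-B a)
      0≤ββSγ : ∀ a → 0ℤ ≤ β * β * Sγ a
      0≤ββSγ a = 0≤* (0≤square β) (0≤spread (filter 𝒞? V) flip-B a)

      -- Weighting each spread by the square of the other set's size puts the two ways of failing on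
      -- the same scale, so one inequality covers both.
      unbalanced : ¬ Any (λ a → Balanced ℬ? a × Balanced 𝒞? a) A → ∀ {a} → a ∈ A → β * β * (γ * γ) ≤ + 4 * (γ * γ * Sβ a + β * β * Sγ a)
      unbalanced ∄a {a} a∈ = [ unbalancedˡ , unbalancedʳ ]′ (¬×¬ (balanced? ℬ? a) (λ b c → ∄a (lose a∈ (b , c))))
        where
        unbalancedˡ : ¬ Balanced ℬ? a → β * β * (γ * γ) ≤ + 4 * (γ * γ * Sβ a + β * β * Sγ a)
        unbalancedˡ ¬b = begin
          β * β * (γ * γ)                       ≡⟨ *-comm (β * β) (γ * γ) ⟩
          γ * γ * (β * β)                       ≤⟨ *-mono (0≤square γ) (≮⇒≥ ¬b) ⟩
          γ * γ * (+ 4 * Sβ a)                  ≤⟨ ≤-from-diff (+ 4 * (β * β * Sγ a)) (0≤* {+ 4} 0≤pos (0≤ββSγ a)) (eq (γ * γ) (Sβ a) (β * β * Sγ a)) ⟩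
          + 4 * (γ * γ * Sβ a + β * β * Sγ a)   ∎
          where
          eq : ∀ g s t → + 4 * (g * s + t) - g * (+ 4 * s) ≡ + 4 * t
          eq = solve-∀

        unbalancedʳ : ¬ Balanced 𝒞? a → β * β * (γ * γ) ≤ + 4 * (γ * γ * Sβ a + β * β * Sγ a)
        unbalancedʳ ¬c = begin
          β * β * (γ * γ)                       ≤⟨ *-mono (0≤square β) (≮⇒≥ ¬c) ⟩
          β * β * (+ 4 * Sγ a)                  ≤⟨ ≤-from-diff (+ 4 * (γ * γ * Sβ a)) (0≤* {+ 4} 0≤pos (0≤γγSβ a)) (eq (β * β) (Sγ a) (γ * γ * Sβ a)) ⟩
          + 4 * (γ * γ * Sβ a + β * β * Sγ a)   ∎
          where
          eq : ∀ g s t → + 4 * (t + g * s) - g * (+ 4 * s) ≡ + 4 * t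
          eq = solve-∀

      ∑A≤ : ∀ k S {s} → 0ℤ ≤ k → (∀ a → 0ℤ ≤ S a) → ∑ V S ≤ s → ∑ A (λ a → k * S a) ≤ k * s
      ∑A≤ k S 0≤k 0≤S ∑S≤s = ≤-trans (≤-reflexive (∑-* A k S)) (*-mono 0≤k (≤-trans (∑-filter-≤ 𝒜? V 0≤S) ∑S≤s))

      -- Sum `unbalanced` over 𝒜 and bound the spreads by their sums over the whole space. The
      -- factor 9 turns each `T` into 9`T`, which the hypotheses absorb, and each of the two spreads
      -- then contributes 4`X`.
      9X≤8X : ¬ Any (λ a → Balanced ℬ? a × Balanced 𝒞? a) A → + 9 * X ≤ + 8 * X
      9X≤8X ∄a = begin
        + 9 * X
          ≡⟨ cong (+ 9 *_) (∑-const A (β * β * (γ * γ))) ⟨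
        + 9 * ∑ A (λ _ → β * β * (γ * γ))
          ≤⟨ *-mono {k = + 9} 0≤pos (∑-mono A (unbalanced ∄a)) ⟩
        + 9 * ∑ A (λ a → + 4 * (γ * γ * Sβ a + β * β * Sγ a))
          ≡⟨ cong (+ 9 *_) (trans (∑-* A (+ 4) (λ a → γ * γ * Sβ a + β * β * Sγ a)) (cong (+ 4 *_) (∑-+ A (λ a → γ * γ * Sβ a) (λ a → β * β * Sγ a)))) ⟩
        + 9 * (+ 4 * (∑ A (λ a → γ * γ * Sβ a) + ∑ A (λ a → β * β * Sγ a)))
          ≤⟨ *-mono {k = + 9} 0≤pos (*-mono {k = + 4} 0≤pos (+-mono-≤
               (∑A≤ (γ * γ) Sβ (0≤square γ) (0≤spread (filter ℬ? V) flip-B) (∑-spread-all ℬ?))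
               (∑A≤ (β * β) Sγ (0≤square β) (0≤spread (filter 𝒞? V) flip-B) (∑-spread-all 𝒞?)))) ⟩
        + 9 * (+ 4 * (γ * γ * (Q * Q * (β * n)) + β * β * (Q * Q * (γ * n))))
          ≡⟨ regroup Q n β γ ⟩
        + 4 * (β * γ) * (γ * (+ 9 * T) + β * (+ 9 * T))
          ≤⟨ *-mono (0≤* {+ 4} 0≤pos (0≤* {β} {γ} 0≤pos 0≤pos)) (+-mono-≤ (*-mono {k = γ} 0≤pos 9T≤αβ) (*-mono {k = β} 0≤pos 9T≤αγ)) ⟩
        + 4 * (β * γ) * (γ * (α * β) + β * (α * γ))
          ≡⟨ collect α β γ ⟩
        + 8 * X
          ∎
        where
        regroup : ∀ Q n β γ → + 9 * (+ 4 * (γ * γ * (Q * Q * (β * n)) + β * β * (Q * Q * (γ * n))))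
                            ≡ + 4 * (β * γ) * (γ * (+ 9 * (Q * Q * n)) + β * (+ 9 * (Q * Q * n)))
        regroup = solve-∀
        collect : ∀ α β γ → + 4 * (β * γ) * (γ * (α * β) + β * (α * γ)) ≡ + 8 * (α * (β * β * (γ * γ)))
        collect = solve-∀

      decide : Dec (Any (λ a → Balanced ℬ? a × Balanced 𝒞? a) A) → ∃ λ a → 𝒜 a × Balanced ℬ? a × Balanced 𝒞? a
      decide (yes p) = let a , a∈ , bal = find p in a , proj₂ (∈-filter⁻ 𝒜? {xs = V} a∈) , bal
      decide (no ∄a) = contradiction 0<X (≤⇒≯ (9i≤8i⇒i≤0 X (9X≤8X ∄a)))

    -- A value l missed by B on U × Y contributes u² to the spread of every point of Y.
    module Missed (a : 𝕍) (aℬ : Balanced ℬ? a) (a𝒞 : Balanced 𝒞? a) (a∈ : 𝒜 a)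
                  (l₁ l₂ : Carrier) (l₂≢0 : l₂ ≢ 0#)
                  (0<β : 0ℤ < β) (0<γ : 0ℤ < γ) where
      open ≤-Reasoning

      -- Spreads are summed over the full level set `W`, where collisions can be bounded; passing to
      -- `Y` only discards nonnegative terms.
      U W Y : List 𝕍
      U = filter (λ b → B a b ≟ l₁) (filter ℬ? V)
      W = filter (λ c → B a c ≟ l₂) V
      Y = filter 𝒞? W

      missed? : Decidable (λ l₃ → ¬ Solvable F d B 𝒜 ℬ 𝒞 (l₁ , l₂ , l₃))
      missed? l₃ = ¬? (solvable? F d B 𝒜? ℬ? 𝒞? (l₁ , l₂ , l₃))

      u v z : ℤ
      u = + length U
      v = + length Y
      z = ∑ Λ (λ l₃ → 𝟙 (missed? l₃))

      hits-u : hits (filter ℬ? V) flip-B a l₁ ≡ u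
      hits-u = sym (length-filter (λ b → B a b ≟ l₁) (filter ℬ? V))

      -- `Y` applies the two filters in the order opposite to `hits`; as products of indicators they
      -- commute.
      hits-v : hits (filter 𝒞? V) flip-B a l₂ ≡ v
      hits-v = begin-equality
        ∑ (filter 𝒞? V) (λ c → 𝟙 (B a c ≟ l₂))      ≡⟨ ∑-filter 𝒞? V _ ⟩
        ∑ V (λ c → 𝟙 (𝒞? c) * 𝟙 (B a c ≟ l₂))       ≡⟨ ∑-cong V (λ {c} _ → *-comm (𝟙 (𝒞? c)) (𝟙 (B a c ≟ l₂))) ⟩
        ∑ V (λ c → 𝟙 (B a c ≟ l₂) * 𝟙 (𝒞? c))       ≡⟨ ∑-filter (λ c → B a c ≟ l₂) V (λ c → 𝟙 (𝒞? c)) ⟨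
        ∑ W (λ c → 𝟙 (𝒞? c))                        ≡⟨ length-filter 𝒞? W ⟨
        v                                           ∎

      β≤2Qu : β ≤ + 2 * (Q * u)
      β≤2Qu = subst (λ s → β ≤ + 2 * (Q * s)) hits-u (balanced-hits ℬ? aℬ l₁)

      γ≤2Qv : γ ≤ + 2 * (Q * v)
      γ≤2Qv = subst (λ s → γ ≤ + 2 * (Q * s)) hits-v (balanced-hits 𝒞? a𝒞 l₂)

      0<u : 0ℤ < u
      0<u = 0<factorʳ (+ 2 * Q) (length U) (<-≤-trans 0<β (≤-trans β≤2Qu (≤-reflexive (sym (*-assoc (+ 2) Q u)))))

      0<v : 0ℤ < v
      0<v = 0<factorʳ (+ 2 * Q) (length Y) (<-≤-trans 0<γ (≤-trans γ≤2Qv (≤-reflexive (sym (*-assoc (+ 2) Q v)))))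

      length-W : + length W ≡ ∑ V (λ c → 𝟙 (B a c ≟ l₂))
      length-W = length-filter (λ c → B a c ≟ l₂) V

      -- Since `Y` is nonempty, `B a` attains the nonzero value `l₂`. Hence it is not the zero
      -- functional, and `level-≤` applies.
      QW≤n : Q * + length W ≤ n
      QW≤n = subst (λ s → Q * s ≤ n) (sym length-W) (level-≤ (linearʳ B bil a) Bac≢0 l₂)
        where
        c∈W : ∃ (_∈ W)
        c∈W = let c , c∈ = inhabited Y 0<v in c , proj₁ (∈-filter⁻ 𝒞? {xs = W} c∈)
        Bac≢0 : B a (proj₁ c∈W) ≢ 0#
        Bac≢0 eq = l₂≢0 (trans (sym (proj₂ (∈-filter⁻ (λ c → B a c ≟ l₂) {xs = V} (proj₂ c∈W)))) eq)

      -- Collisions on `W` are the zeros of `B (x' ⊖ᵛ x)` inside {`B a` = `l₂`}. As `l₂` is nonzero,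
      -- `section-≤` bounds them even when the two functionals are proportional.
      ∑-spread-W : ∑ W (spread U B) ≤ Q * Q * (u * + length W)
      ∑-spread-W = ∑-spread U B _≟ᵛ_ (filter⁺ _ (filter⁺ ℬ? (unique (vectors F d)))) W few
        where
        few : ∀ {x x'} → x ∈ U → x' ∈ U → x ≢ x' → Q * ∑ W (λ y → 𝟙 (B x' y ≟ B x y)) ≤ + length W
        few {x} {x'} _ _ x≢x' = begin
          Q * ∑ W (λ y → 𝟙 (B x' y ≟ B x y))
            ≡⟨ cong (Q *_) (∑-cong W (λ {y} _ → 𝟙-differenceˡ B bil x' x y)) ⟩
          Q * ∑ W (λ y → 𝟙 (B (x' ⊖ᵛ x) y ≟ 0#))
            ≡⟨ cong (Q *_) (∑-filter (λ c → B a c ≟ l₂) V (λ y → 𝟙 (B (x' ⊖ᵛ x) y ≟ 0#))) ⟩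
          Q * ∑ V (λ y → 𝟙 (B a y ≟ l₂) * 𝟙 (B (x' ⊖ᵛ x) y ≟ 0#))
            ≤⟨ section-≤ (linearʳ B bil a) (linearʳ B bil (x' ⊖ᵛ x)) (proj₂ (separateˡ B bil nd (λ eq → x≢x' (sym eq)))) l₂≢0 ⟩
          ∑ V (λ y → 𝟙 (B a y ≟ l₂))
            ≡⟨ length-W ⟨
          + length W
            ∎

      -- A hit `b` would complete `a` and `c` to a solution.
      missed-hits : ∀ {c} → c ∈ Y → ∀ {l} → ¬ Solvable F d B 𝒜 ℬ 𝒞 (l₁ , l₂ , l) → hits U B c l ≡ 0ℤ
      missed-hits {c} c∈Y {l} unsolvable = begin-equality
        ∑ U (λ b → 𝟙 (B b c ≟ l))   ≡⟨ ∑-cong U (λ {b} b∈U → 𝟙-no (B b c ≟ l) (λ Bbc≡l → unsolvable (solution b∈U Bbc≡l))) ⟩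
        ∑ U (λ _ → 0ℤ)              ≡⟨ ∑-const U 0ℤ ⟩
        u * 0ℤ                      ≡⟨ *-zeroʳ u ⟩
        0ℤ                          ∎
        where
        solution : ∀ {b} → b ∈ U → B b c ≡ l → Solvable F d B 𝒜 ℬ 𝒞 (l₁ , l₂ , l)
        solution {b} b∈U Bbc≡l =
          let b∈ℬ , Bab≡l₁ = ∈-filter⁻ (λ b → B a b ≟ l₁) {xs = filter ℬ? V} b∈U
              c∈W , c∈𝒞    = ∈-filter⁻ 𝒞? {xs = W} c∈Y
          in a , b , c , (a∈ , proj₂ (∈-filter⁻ ℬ? {xs = V} b∈ℬ) , c∈𝒞)
               , Bab≡l₁ , proj₂ (∈-filter⁻ (λ c → B a c ≟ l₂) {xs = V} c∈W) , Bbc≡l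

      missed-≤-spread : ∀ {c} → c ∈ Y → u * u * z ≤ spread U B c
      missed-≤-spread {c} c∈Y = begin
        u * u * z                                ≡⟨ ∑-* Λ (u * u) (λ l → 𝟙 (missed? l)) ⟨
        ∑ Λ (λ l → u * u * 𝟙 (missed? l))        ≤⟨ ∑-mono Λ (λ {l} _ → term l (missed? l)) ⟩
        spread U B c                             ∎
        where
        term : ∀ l (m : Dec (¬ Solvable F d B 𝒜 ℬ 𝒞 (l₁ , l₂ , l))) →
               u * u * 𝟙 m ≤ (Q * hits U B c l - u) * (Q * hits U B c l - u)
        term l (no _)  = ≤-trans (≤-reflexive (*-zeroʳ (u * u))) (0≤square (Q * hits U B c l - u))
        term l (yes m) = ≤-reflexive (trans (eq Q u) (cong (λ h → (Q * h - u) * (Q * h - u)) (sym (missed-hits c∈Y m))))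
          where
          eq : ∀ Q u → u * u * 1ℤ ≡ (Q * 0ℤ - u) * (Q * 0ℤ - u)
          eq = solve-∀

      -- Compares the lower bound for the spread on `Y` with the upper bound on `W`. The extra
      -- factor `Q` turns the length of `W` into `n`.
      Qvuuz≤Tu : Q * (v * (u * u * z)) ≤ T * u
      Qvuuz≤Tu = begin
        Q * (v * (u * u * z))               ≡⟨ cong (Q *_) (∑-const Y (u * u * z)) ⟨
        Q * ∑ Y (λ _ → u * u * z)           ≤⟨ *-mono {k = Q} 0≤pos (∑-mono Y missed-≤-spread) ⟩
        Q * ∑ Y (spread U B)                ≤⟨ *-mono {k = Q} 0≤pos (∑-filter-≤ 𝒞? W (0≤spread U B)) ⟩
        Q * ∑ W (spread U B)                ≤⟨ *-mono {k = Q} 0≤pos ∑-spread-W ⟩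
        Q * (Q * Q * (u * + length W))      ≡⟨ eq₁ Q u (+ length W) ⟩
        Q * Q * u * (Q * + length W)        ≤⟨ *-mono (0≤* {Q * Q} {u} (0≤square Q) 0≤pos) QW≤n ⟩
        Q * Q * u * n                       ≡⟨ eq₂ Q u n ⟩
        T * u                               ∎
        where
        eq₁ : ∀ Q u w → Q * (Q * Q * (u * w)) ≡ Q * Q * u * (Q * w)
        eq₁ = solve-∀
        eq₂ : ∀ Q u n → Q * Q * u * n ≡ Q * Q * n * u
        eq₂ = solve-∀

      0≤z : 0ℤ ≤ z
      0≤z = 0≤∑ Λ (λ l → 0≤𝟙 (missed? l))

      -- Multiply through by `T * u`, which is positive. The half-size bounds on `u` and `v` give
      -- `β * γ` ≤ 4`Q`²`uv`, the source of the constant 4, and `Qvuuz≤Tu` absorbs the rest.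
      missed-≤ : ∀ D → D * T ≤ β * γ → D * z ≤ + 4 * Q
      missed-≤ D DT≤βγ = *-cancelʳ-≤-pos (D * z) (+ 4 * Q) (T * u) {{positive (0<* {T} {u} 0<T 0<u)}} (begin
        D * z * (T * u)                               ≡⟨ eq₁ D z T u ⟩
        z * u * (D * T)                               ≤⟨ *-mono 0≤zu DT≤βγ ⟩
        z * u * (β * γ)                               ≤⟨ *-mono 0≤zu (*-mono₂ {β} {+ 2 * (Q * u)} {γ} {+ 2 * (Q * v)} 0≤pos (≤-trans (<⇒≤ 0<γ) γ≤2Qv) β≤2Qu γ≤2Qv) ⟩
        z * u * (+ 2 * (Q * u) * (+ 2 * (Q * v)))     ≡⟨ eq₂ Q z u v ⟩
        + 4 * Q * (Q * (v * (u * u * z)))             ≤⟨ *-mono (0≤* {+ 4} {Q} 0≤pos 0≤pos) Qvuuz≤Tu ⟩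
        + 4 * Q * (T * u)                             ∎)
        where
        0≤zu : 0ℤ ≤ z * u
        0≤zu = 0≤* {z} {u} 0≤z 0≤pos
        eq₁ : ∀ D z T u → D * z * (T * u) ≡ z * u * (D * T)
        eq₁ = solve-∀
        eq₂ : ∀ Q z u v → z * u * (+ 2 * (Q * u) * (+ 2 * (Q * v))) ≡ + 4 * Q * (Q * (v * (u * u * z)))
        eq₂ = solve-∀

    solved : Carrier → Carrier → ℤ
    solved l₁ l₂ = ∑ Λ (λ l₃ → 𝟙 (nonZeroSolvable? F d B 𝒜? ℬ? 𝒞? (l₁ , l₂ , l₃)))

    -- With every triple given weight `K`, each of the three zero coordinates costs at most `K Q`²
    -- and the missed values cost at most 4`Q`³. The bound 9 ≤ `K` ≤ `D` provides the density for
    -- `balanced-point`.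
    solvable-≥ : ∀ K D → + 9 ≤ K → K ≤ D → K ≤ Q → D * T ≤ α * β → D * T ≤ α * γ → D * T ≤ β * γ →
                 K * (Q * (Q * Q)) ≤ K * + #solvable F d B 𝒜? ℬ? 𝒞? + + 7 * (Q * (Q * Q))
    solvable-≥ K D 9≤K K≤D K≤Q DT≤αβ DT≤αγ DT≤βγ = begin
      K * (Q * (Q * Q))
        ≡⟨ eq₀ K Q ⟩
      Q * (Q * (K * Q))
        ≡⟨ trans (∑Λ-const (∑ Λ (λ _ → K * Q))) (cong (Q *_) (∑Λ-const (K * Q))) ⟨
      ∑ Λ (λ _ → ∑ Λ (λ _ → K * Q))
        ≤⟨ ∑-mono Λ (λ {l₁} _ → plane l₁) ⟩
      ∑ Λ (λ l₁ → K * ∑ Λ (solved l₁) + (𝟙 (0# ≟ l₁) * (Q * (K * Q)) + (K * Q + Q * r)))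
        ≡⟨ trans (∑-+ Λ (λ l₁ → K * ∑ Λ (solved l₁)) (λ l₁ → 𝟙 (0# ≟ l₁) * (Q * (K * Q)) + (K * Q + Q * r)))
                 (cong₂ _+_ (∑-* Λ K (λ l₁ → ∑ Λ (solved l₁))) (∑-zero (Q * (K * Q)) (K * Q + Q * r))) ⟩
      K * ∑ Λ (λ l₁ → ∑ Λ (solved l₁)) + (Q * (K * Q) + Q * (K * Q + Q * r))
        ≤⟨ +-monoʳ-≤ (K * ∑ Λ (λ l₁ → ∑ Λ (solved l₁)))
             -- The total loss 3`K Q`² + 4`Q`³ is at most 7`Q`³ because `K` ≤ `Q`.
             (≤-from-diff (+ 3 * (Q * Q * (Q - K))) (0≤* {+ 3} 0≤pos (0≤* (0≤square Q) (i≤j⇒0≤j-i K≤Q))) (eq₁ K Q)) ⟩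
      K * ∑ Λ (λ l₁ → ∑ Λ (solved l₁)) + + 7 * (Q * (Q * Q))
        ≡⟨ cong (λ s → K * s + + 7 * (Q * (Q * Q))) total ⟨
      K * + #solvable F d B 𝒜? ℬ? 𝒞? + + 7 * (Q * (Q * Q))
        ∎
      where
      open ≤-Reasoning
      -- Weighted loss on a line with `l₁` and `l₂` nonzero: `K` for `l₃` = 0 and 4`Q` for the
      -- missed values.
      r = K + + 4 * Q

      eq₀ : ∀ K Q → K * (Q * (Q * Q)) ≡ Q * (Q * (K * Q))
      eq₀ = solve-∀
      eq₁ : ∀ K Q → + 7 * (Q * (Q * Q)) - (Q * (K * Q) + Q * (K * Q + Q * (K + + 4 * Q))) ≡ + 3 * (Q * Q * (Q - K))
      eq₁ = solve-∀

      total : + #solvable F d B 𝒜? ℬ? 𝒞? ≡ ∑ Λ (λ l₁ → ∑ Λ (solved l₁))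
      total = trans (length-filter (nonZeroSolvable? F d B 𝒜? ℬ? 𝒞?) (cartesianProduct Λ (cartesianProduct Λ Λ)))
        (trans (∑-product _,_ Λ (cartesianProduct Λ Λ) _) (∑-cong Λ (λ _ → ∑-product _,_ Λ Λ _)))

      ∑-zero : ∀ x y → ∑ Λ (λ l → 𝟙 (0# ≟ l) * x + y) ≡ x + Q * y
      ∑-zero x y = trans (∑-+ Λ (λ l → 𝟙 (0# ≟ l) * x) (λ _ → y))
        (cong₂ _+_ (∑-δ _≟_ (λ _ → x) (unique listing) (complete listing 0#)) (∑Λ-const y))

      0≤K : 0ℤ ≤ K
      0≤K = ≤-trans 0≤pos 9≤K

      0≤T : 0ℤ ≤ T
      0≤T = <⇒≤ 0<T

      9T≤DT : + 9 * T ≤ D * T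
      9T≤DT = *-monoʳ-≤-nonNeg T {{nonNegative 0≤T}} (≤-trans 9≤K K≤D)

      0<DT : 0ℤ < D * T
      0<DT = <-≤-trans (0<* {+ 9} {T} (+<+ ℕ.z<s) 0<T) 9T≤DT

      0<α : 0ℤ < α
      0<α = 0<factorʳ β (card F d 𝒜?) (<-≤-trans 0<DT (≤-trans DT≤αβ (≤-reflexive (*-comm α β))))
      0<β : 0ℤ < β
      0<β = 0<factorʳ α (card F d ℬ?) (<-≤-trans 0<DT DT≤αβ)
      0<γ : 0ℤ < γ
      0<γ = 0<factorʳ α (card F d 𝒞?) (<-≤-trans 0<DT DT≤αγ)

      -- Chosen before `l₁` and `l₂`, so the same `a` serves every line.
      point : ∃ λ a → 𝒜 a × Balanced ℬ? a × Balanced 𝒞? a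
      point = balanced-point 0<α 0<β 0<γ (≤-trans 9T≤DT DT≤αβ) (≤-trans 9T≤DT DT≤αγ)

      0≤KQ : 0ℤ ≤ K * Q
      0≤KQ = 0≤* {K} {Q} 0≤K 0≤pos

      0≤solved : ∀ l₁ l₂ → 0ℤ ≤ solved l₁ l₂
      0≤solved l₁ l₂ = 0≤∑ Λ (λ l₃ → 0≤𝟙 (nonZeroSolvable? F d B 𝒜? ℬ? 𝒞? (l₁ , l₂ , l₃)))

      -- If `l₁` or `l₂` is zero, the whole line is charged to the corresponding indicator.
      -- Otherwise every `l₃` is solved, zero or missed, and `missed-≤` bounds the last kind.
      line : ∀ l₁ l₂ → Dec (0# ≡ l₁) → Dec (0# ≡ l₂) →
             K * Q ≤ K * solved l₁ l₂ + (𝟙 (0# ≟ l₁) * (K * Q) + (𝟙 (0# ≟ l₂) * (K * Q) + r))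
      line l₁ l₂ (yes 0≡l₁) _ = subst (λ i → K * Q ≤ K * solved l₁ l₂ + (i * (K * Q) + (𝟙 (0# ≟ l₂) * (K * Q) + r))) (sym (𝟙-yes (0# ≟ l₁) 0≡l₁))
        (≤-from-diff (K * solved l₁ l₂ + (𝟙 (0# ≟ l₂) * (K * Q) + r))
          (0≤+ (0≤* 0≤K (0≤solved l₁ l₂)) (0≤+ (0≤* (0≤𝟙 (0# ≟ l₂)) 0≤KQ) (0≤+ 0≤K (0≤* {+ 4} {Q} 0≤pos 0≤pos))))
          (eq (K * Q) (K * solved l₁ l₂) (𝟙 (0# ≟ l₂) * (K * Q) + r)))
        where
        eq : ∀ k s t → s + (1ℤ * k + t) - k ≡ s + t
        eq = solve-∀
      line l₁ l₂ (no _) (yes 0≡l₂) = subst (λ i → K * Q ≤ K * solved l₁ l₂ + (𝟙 (0# ≟ l₁) * (K * Q) + (i * (K * Q) + r))) (sym (𝟙-yes (0# ≟ l₂) 0≡l₂))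
        (≤-from-diff (K * solved l₁ l₂ + (𝟙 (0# ≟ l₁) * (K * Q) + r))
          (0≤+ (0≤* 0≤K (0≤solved l₁ l₂)) (0≤+ (0≤* (0≤𝟙 (0# ≟ l₁)) 0≤KQ) (0≤+ 0≤K (0≤* {+ 4} {Q} 0≤pos 0≤pos))))
          (eq (K * Q) (K * solved l₁ l₂) (𝟙 (0# ≟ l₁) * (K * Q)) r))
        where
        eq : ∀ k s x t → s + (x + (1ℤ * k + t)) - k ≡ s + (x + t)
        eq = solve-∀
      line l₁ l₂ (no 0≢l₁) (no 0≢l₂) = begin
        K * Q
          ≡⟨ cong (K *_) (trans (∑Λ-const 1ℤ) (*-identityʳ Q)) ⟨
        K * ∑ Λ (λ _ → 1ℤ)
          ≤⟨ *-mono 0≤K (∑-mono Λ (λ {l₃} _ → cover l₃ (0# ≟ l₃) (missed? l₃) (nonZeroSolvable? F d B 𝒜? ℬ? 𝒞? (l₁ , l₂ , l₃)))) ⟩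
        K * ∑ Λ (λ l₃ → 𝟙 (nonZeroSolvable? F d B 𝒜? ℬ? 𝒞? (l₁ , l₂ , l₃)) + (𝟙 (0# ≟ l₃) + 𝟙 (missed? l₃)))
          ≡⟨ cong (K *_) (trans (∑-+ Λ _ _) (cong (λ s → solved l₁ l₂ + s)
               (trans (∑-+ Λ _ _) (cong (λ s → s + z) (∑-δ-1 _≟_ (unique listing) (complete listing 0#)))))) ⟩
        K * (solved l₁ l₂ + (1ℤ + z))
          ≡⟨ eq₂ K (solved l₁ l₂) z ⟩
        K * solved l₁ l₂ + (K + K * z)
          ≤⟨ +-monoʳ-≤ (K * solved l₁ l₂) (+-monoʳ-≤ K (≤-trans (*-monoʳ-≤-nonNeg z {{nonNegative 0≤z}} K≤D) (missed-≤ D DT≤βγ))) ⟩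
        K * solved l₁ l₂ + r
          ≤⟨ +-monoʳ-≤ (K * solved l₁ l₂) (≤-from-diff (𝟙 (0# ≟ l₁) * (K * Q) + 𝟙 (0# ≟ l₂) * (K * Q))
               (0≤+ (0≤* (0≤𝟙 (0# ≟ l₁)) 0≤KQ) (0≤* (0≤𝟙 (0# ≟ l₂)) 0≤KQ))
               (eq₃ r (𝟙 (0# ≟ l₁) * (K * Q)) (𝟙 (0# ≟ l₂) * (K * Q)))) ⟩
        K * solved l₁ l₂ + (𝟙 (0# ≟ l₁) * (K * Q) + (𝟙 (0# ≟ l₂) * (K * Q) + r))
          ∎
        where
        a = proj₁ point
        open Missed a (proj₁ (proj₂ (proj₂ point))) (proj₂ (proj₂ (proj₂ point))) (proj₁ (proj₂ point))
                    l₁ l₂ (λ eq → 0≢l₂ (sym eq)) 0<β 0<γ using (missed?; z; 0≤z; missed-≤)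
        eq₂ : ∀ K s z → K * (s + (1ℤ + z)) ≡ K * s + (K + K * z)
        eq₂ = solve-∀
        eq₃ : ∀ r x y → x + (y + r) - r ≡ x + y
        eq₃ = solve-∀

        cover : ∀ l₃ (o : Dec (0# ≡ l₃)) (m : Dec (¬ Solvable F d B 𝒜 ℬ 𝒞 (l₁ , l₂ , l₃)))
                (s : Dec (NonZeroSolvable F d B 𝒜 ℬ 𝒞 (l₁ , l₂ , l₃))) → 1ℤ ≤ 𝟙 s + (𝟙 o + 𝟙 m)
        cover l₃ o       m       (yes _) = +-monoʳ-≤ 1ℤ (0≤+ (0≤𝟙 o) (0≤𝟙 m))
        cover l₃ (yes _) (yes _) (no _)  = +≤+ (ℕ.s≤s ℕ.z≤n)
        cover l₃ (yes _) (no _)  (no _)  = ≤-refl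
        cover l₃ (no _)  (yes _) (no _)  = ≤-refl
        -- Not being missed gives only the double negation of solvability, which is enough to refute
        -- `¬s`.
        cover l₃ (no 0≢l₃) (no ¬m) (no ¬s) = contradiction
          (λ s → ¬s (((λ eq → 0≢l₁ (sym eq)) , (λ eq → 0≢l₂ (sym eq)) , (λ eq → 0≢l₃ (sym eq))) , s)) ¬m

      plane : ∀ l₁ → ∑ Λ (λ _ → K * Q) ≤ K * ∑ Λ (solved l₁) + (𝟙 (0# ≟ l₁) * (Q * (K * Q)) + (K * Q + Q * r))
      plane l₁ = begin
        ∑ Λ (λ _ → K * Q)
          ≤⟨ ∑-mono Λ (λ {l₂} _ → line l₁ l₂ (0# ≟ l₁) (0# ≟ l₂)) ⟩
        ∑ Λ (λ l₂ → K * solved l₁ l₂ + (𝟙 (0# ≟ l₁) * (K * Q) + (𝟙 (0# ≟ l₂) * (K * Q) + r)))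
          ≡⟨ trans (∑-+ Λ (λ l₂ → K * solved l₁ l₂) (λ l₂ → 𝟙 (0# ≟ l₁) * (K * Q) + (𝟙 (0# ≟ l₂) * (K * Q) + r)))
               (cong₂ _+_ (∑-* Λ K (solved l₁))
                 (trans (∑-+ Λ (λ _ → 𝟙 (0# ≟ l₁) * (K * Q)) (λ l₂ → 𝟙 (0# ≟ l₂) * (K * Q) + r))
                   (cong₂ _+_ (∑Λ-const (𝟙 (0# ≟ l₁) * (K * Q))) (∑-zero (K * Q) r)))) ⟩
        K * ∑ Λ (solved l₁) + (Q * (𝟙 (0# ≟ l₁) * (K * Q)) + (K * Q + Q * r))
          ≡⟨ cong (λ s → K * ∑ Λ (solved l₁) + (s + (K * Q + Q * r))) (eq₄ Q (𝟙 (0# ≟ l₁)) K) ⟩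
        K * ∑ Λ (solved l₁) + (𝟙 (0# ≟ l₁) * (Q * (K * Q)) + (K * Q + Q * r))
          ∎
        where
        eq₄ : ∀ Q i K → Q * (i * (K * Q)) ≡ i * (Q * (K * Q))
        eq₄ = solve-∀

-- Passage between rational and integer inequalities

module Rationals where
  open import Data.Integer.Base as ℤ using (ℤ; +_; 1ℤ)
  import Data.Integer.Properties as ℤ
  open import Data.Integer.Tactic.RingSolver using (solve-∀)
  import Data.Nat.Base as ℕ
  import Data.Nat.Properties as ℕ
  open import Data.Nat.Base using (ℕ; suc)
  open import Data.Rational.Base
  open import Data.Rational.Properties
  open import Data.Rational.Unnormalised.Base as ℚᵘ using (ℚᵘ; mkℚᵘ)
  import Data.Rational.Unnormalised.Properties as ℚᵘ
  open import Relation.Binary.PropositionalEquality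
  open Sums using (≤-from-diff; 0≤+; 0≤*; 0≤pos)

  -- The denominator is stored as its predecessor, so 0 stands for 1.
  intᵘ : ℕ → ℚᵘ
  intᵘ n = mkℚᵘ (+ n) 0

  toℚᵘ-fromℕ : ∀ n → toℚᵘ (fromℕ n) ℚᵘ.≃ intᵘ n
  toℚᵘ-fromℕ n = toℚᵘ-fromℚᵘ (intᵘ n)

  fromℕ-positive : ∀ n .{{_ : ℕ.NonZero n}} → 0ℚ < fromℕ n
  fromℕ-positive n = positive⁻¹ (fromℕ n) {{normalize-pos n 1}}

  fromℕ-*-cancel-≤ : ∀ m n p → fromℕ m * fromℕ n ≤ fromℕ p → m ℕ.* n ℕ.≤ p
  fromℕ-*-cancel-≤ m n p mn≤p = ℤ.drop‿+≤+ (subst₂ ℤ._≤_ lhs (ℤ.*-identityʳ (+ p)) (ℚᵘ.drop-*≤* le))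
    where
    open ℚᵘ.≤-Reasoning
    le : intᵘ m ℚᵘ.* intᵘ n ℚᵘ.≤ intᵘ p
    le = begin
      intᵘ m ℚᵘ.* intᵘ n                       ≃⟨ ℚᵘ.*-cong (toℚᵘ-fromℕ m) (toℚᵘ-fromℕ n) ⟨
      toℚᵘ (fromℕ m) ℚᵘ.* toℚᵘ (fromℕ n)       ≃⟨ toℚᵘ-homo-* (fromℕ m) (fromℕ n) ⟨
      toℚᵘ (fromℕ m * fromℕ n)                 ≤⟨ toℚᵘ-mono-≤ mn≤p ⟩
      toℚᵘ (fromℕ p)                           ≃⟨ toℚᵘ-fromℕ p ⟩
      intᵘ p                                   ∎
    lhs : + m ℤ.* + n ℤ.* 1ℤ ≡ + (m ℕ.* n)
    lhs = trans (ℤ.*-identityʳ (+ m ℤ.* + n)) (sym (ℤ.pos-* m n))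

  -- A positive `ε` is at least 1 / `↧ₙ ε`, so the relative loss 7 / `K` = 7 / (9 `↧ₙ ε`) stays
  -- below it.
  1-ε-bound : ∀ {ε} → 0ℚ < ε → ∀ n s →
              let K = + (9 ℕ.* ↧ₙ ε) in K ℤ.* + n ℤ.≤ K ℤ.* + s ℤ.+ + 7 ℤ.* + n →
              (1ℚ - ε) * fromℕ n ≤ fromℕ s
  1-ε-bound {ε@(mkℚ (+ suc k) e _)} 0<ε n s bound = toℚᵘ-cancel-≤ (begin
    toℚᵘ ((1ℚ - ε) * fromℕ n)                                ≃⟨ toℚᵘ-homo-* (1ℚ - ε) (fromℕ n) ⟩
    toℚᵘ (1ℚ - ε) ℚᵘ.* toℚᵘ (fromℕ n)                        ≃⟨ ℚᵘ.*-cong (toℚᵘ-homo-+ 1ℚ (- ε)) (toℚᵘ-fromℕ n) ⟩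
    (toℚᵘ 1ℚ ℚᵘ.+ toℚᵘ (- ε)) ℚᵘ.* intᵘ n                    ≃⟨ ℚᵘ.*-congʳ (ℚᵘ.+-congʳ (toℚᵘ 1ℚ) (toℚᵘ-homo‿- ε)) ⟩
    (intᵘ 1 ℚᵘ.+ mkℚᵘ (ℤ.- + suc k) e) ℚᵘ.* intᵘ n           ≤⟨ ℚᵘ.*≤* goal ⟩
    intᵘ s                                                   ≃⟨ toℚᵘ-fromℕ s ⟨
    toℚᵘ (fromℕ s)                                           ∎)
    where
    open ℚᵘ.≤-Reasoning
    goal : ℚᵘ.↥ ((intᵘ 1 ℚᵘ.+ mkℚᵘ (ℤ.- + suc k) e) ℚᵘ.* intᵘ n) ℤ.* 1ℤ ℤ.≤ + s ℤ.* ℚᵘ.↧ ((intᵘ 1 ℚᵘ.+ mkℚᵘ (ℤ.- + suc k) e) ℚᵘ.* intᵘ n)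
    -- The denominator of the product computes to the successor of (`e` + 0) * 1, which has to be
    -- rewritten to `e`.
    goal = subst (λ t → numerator ℤ.≤ + s ℤ.* + suc t) (sym (trans (ℕ.*-identityʳ (e ℕ.+ 0)) (ℕ.+-identityʳ e)))
      -- After scaling by 9, the term for `ε` is 9(`k` + 1)`N`. Of this, 7`N` pays for the loss in
      -- `bound′`, and 9`k N` + 2`N` is left over.
      (ℤ.*-cancelˡ-≤-pos numerator (S ℤ.* E) (+ 9) (≤-from-diff
        (+ 9 ℤ.* E ℤ.* S ℤ.+ + 7 ℤ.* N ℤ.- + 9 ℤ.* E ℤ.* N ℤ.+ (+ 9 ℤ.* (+ k ℤ.* N) ℤ.+ + 2 ℤ.* N))
        (0≤+ (ℤ.i≤j⇒0≤j-i bound′) (0≤+ (0≤* {+ 9} 0≤pos (0≤* {+ k} {N} 0≤pos 0≤pos)) (0≤* {+ 2} {N} 0≤pos 0≤pos)))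
        (eq E N S (+ k))))
      where
      E N S numerator : ℤ
      E = + suc e
      N = + n
      S = + s
      numerator = (1ℤ ℤ.* E ℤ.+ (ℤ.- (1ℤ ℤ.+ + k)) ℤ.* 1ℤ) ℤ.* N ℤ.* 1ℤ
      bound′ : + 9 ℤ.* E ℤ.* N ℤ.≤ + 9 ℤ.* E ℤ.* S ℤ.+ + 7 ℤ.* N
      bound′ = subst (λ K → K ℤ.* N ℤ.≤ K ℤ.* S ℤ.+ + 7 ℤ.* N) (ℤ.pos-* 9 (suc e)) bound
      eq : ∀ E N S k → + 9 ℤ.* (S ℤ.* E) ℤ.- + 9 ℤ.* ((1ℤ ℤ.* E ℤ.+ (ℤ.- (1ℤ ℤ.+ k)) ℤ.* 1ℤ) ℤ.* N ℤ.* 1ℤ)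
                     ≡ + 9 ℤ.* E ℤ.* S ℤ.+ + 7 ℤ.* N ℤ.- + 9 ℤ.* E ℤ.* N ℤ.+ (+ 9 ℤ.* (k ℤ.* N) ℤ.+ + 2 ℤ.* N)
      eq = solve-∀
  1-ε-bound {mkℚ (+ 0) _ _} (*<* (ℤ.+<+ ()))
  1-ε-bound {mkℚ (ℤ.-[1+ _ ]) _ _} (*<* ())

-- The density hypotheses as powers of q

module Reduction {q : ℕ} (F : FiniteField q) (d : ℕ)
                 (B : Vector F d → Vector F d → FiniteField.Carrier F)
                 (bil : IsBilinear F d B) (nd : IsNonDegenerate F d B) where
  open import Data.Integer.Base using (+_; +≤+)
  import Data.Integer.Base as ℤ
  import Data.Integer.Properties as ℤ
  open import Data.List.Base using (length)
  open import Data.List.Properties using () renaming (length-filter to length-filter-≤)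
  open import Data.Nat.Base
  open import Data.Nat.Properties
  open import Level using (0ℓ)
  open import Relation.Binary.PropositionalEquality
  open import Relation.Unary using (Pred; Decidable)
  open Linear F d using (V; 𝕍; length-vectors)
  open Counting F d B bil nd using (T; 0<Q; solvable-≥)

  T≡ : T ≡ + (q ^ (d + 2))
  T≡ = begin
    + q ℤ.* + q ℤ.* + length V   ≡⟨ cong (λ n → + q ℤ.* + q ℤ.* + n) (length-vectors d) ⟩
    + q ℤ.* + q ℤ.* + (q ^ d)    ≡⟨ cong (ℤ._* + (q ^ d)) (ℤ.pos-* q q) ⟨
    + (q * q) ℤ.* + (q ^ d)      ≡⟨ ℤ.pos-* (q * q) (q ^ d) ⟨
    + (q * q * q ^ d)            ≡⟨ cong +_ (trans (*-comm (q * q) (q ^ d)) (cong (λ r → q ^ d * (q * r)) (sym (*-identityʳ q)))) ⟩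
    + (q ^ d * q ^ 2)            ≡⟨ cong +_ (^-distribˡ-+-* q d 2) ⟨
    + (q ^ (d + 2))              ∎
    where open ≡-Reasoning

  card≤ : {P : Pred 𝕍 0ℓ} (P? : Decidable P) → card F d P? ≤ q ^ d
  card≤ P? = ≤-trans (length-filter-≤ P? V) (≤-reflexive (length-vectors d))

  instance
    q-nonZero : NonZero q
    q-nonZero = >-nonZero (ℤ.drop‿+<+ 0<Q)

  module _ {𝒜 ℬ 𝒞 : Pred 𝕍 0ℓ} (𝒜? : Decidable 𝒜) (ℬ? : Decidable ℬ) (𝒞? : Decidable 𝒞) where

    -- The sets have at most `q ^ d` elements each, so density `K ^ d` times `q ^ (d + 2)` cannot be
    -- reached when `K` exceeds `q`. Taking the density constant to be a `d`-th power makes this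
    -- comparison immediate.
    K≤q : ∀ K → .{{_ : NonZero d}} → K ^ d * q ^ (d + 2) ≤ card F d 𝒜? * card F d ℬ? → K ≤ q
    K≤q K dense = ≮⇒≥ λ q<K → <-irrefl refl (begin-strict
      q ^ d * q ^ d                      <⟨ *-monoˡ-< (q ^ d) {{m^n≢0 q d}} (^-monoˡ-< d q<K) ⟩
      K ^ d * q ^ d                      ≤⟨ *-monoʳ-≤ (K ^ d) (^-monoʳ-≤ q (m≤m+n d 2)) ⟩
      K ^ d * q ^ (d + 2)                ≤⟨ dense ⟩
      card F d 𝒜? * card F d ℬ?          ≤⟨ *-mono-≤ (card≤ 𝒜?) (card≤ ℬ?) ⟩
      q ^ d * q ^ d                      ∎)
      where open ≤-Reasoning

    -- Applies `solvable-≥` with `D` = `K ^ d`; the exponent is positive, so `K` ≤ `D`.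
    #solvable-≥ : ∀ K → 9 ≤ K → .{{_ : NonZero K}} → .{{_ : NonZero d}} →
      K ^ d * q ^ (d + 2) ≤ card F d 𝒜? * card F d ℬ? →
      K ^ d * q ^ (d + 2) ≤ card F d 𝒜? * card F d 𝒞? →
      K ^ d * q ^ (d + 2) ≤ card F d ℬ? * card F d 𝒞? →
      + K ℤ.* + (q ^ 3) ℤ.≤ + K ℤ.* + #solvable F d B 𝒜? ℬ? 𝒞? ℤ.+ + 7 ℤ.* + (q ^ 3)
    #solvable-≥ K 9≤K 𝒜ℬ 𝒜𝒞 ℬ𝒞 =
      subst (λ c → + K ℤ.* c ℤ.≤ + K ℤ.* + #solvable F d B 𝒜? ℬ? 𝒞? ℤ.+ + 7 ℤ.* c) cube
        (solvable-≥ 𝒜? ℬ? 𝒞? (+ K) (+ (K ^ d)) (+≤+ 9≤K) (+≤+ K≤K^d) (+≤+ (K≤q K 𝒜ℬ))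
          (cast (card F d 𝒜?) _ 𝒜ℬ) (cast (card F d 𝒜?) _ 𝒜𝒞) (cast (card F d ℬ?) _ ℬ𝒞))
      where
      cube : + q ℤ.* (+ q ℤ.* + q) ≡ + (q ^ 3)
      cube = begin
        + q ℤ.* (+ q ℤ.* + q)   ≡⟨ cong (+ q ℤ.*_) (ℤ.pos-* q q) ⟨
        + q ℤ.* + (q * q)       ≡⟨ ℤ.pos-* q (q * q) ⟨
        + (q * (q * q))         ≡⟨ cong (λ r → + (q * (q * r))) (*-identityʳ q) ⟨
        + (q ^ 3)               ∎
        where open ≡-Reasoning

      K≤K^d : K ≤ K ^ d
      K≤K^d = ≤-trans (≤-reflexive (sym (^-identityʳ K))) (^-monoʳ-≤ K (>-nonZero⁻¹ d))

      cast : ∀ x y → K ^ d * q ^ (d + 2) ≤ x * y → + (K ^ d) ℤ.* T ℤ.≤ + x ℤ.* + y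
      cast x y le = subst₂ ℤ._≤_ (trans (ℤ.pos-* (K ^ d) (q ^ (d + 2))) (cong (+ (K ^ d) ℤ.*_) (sym T≡))) (ℤ.pos-* x y) (+≤+ le)

-- Choice of the constant and conclusion

open import Data.Nat.Base using (ℕ; _^_) renaming (_≤_ to _≤ⁿ_; _*_ to _*ⁿ_; _+_ to _+ⁿ_)
open import Data.Product.Base using (Σ; _×_)
open import Data.Rational.Base using (ℚ; 0ℚ; 1ℚ; _<_; _≤_; _*_; _-_)
open import Level using (0ℓ)
open import Relation.Unary using (Pred; Decidable)

open import Data.Nat.Base using (s≤s)
open import Data.Nat.Properties using (m≤m*n; m^n≢0)
open import Data.Product.Base using (_,_)
open import Data.Rational.Base using (↧ₙ_)
open Rationals using (fromℕ-positive; fromℕ-*-cancel-≤; 1-ε-bound)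
open Reduction using (#solvable-≥)

theorem1p4 : (d : ℕ) → 3 ≤ⁿ d →
    (ε : ℚ) → 0ℚ < ε →
    Σ ℚ λ C → 0ℚ < C ×
    ((q : ℕ) → IsPrimePower q → (F : FiniteField q) →
    (B : Vector F d → Vector F d → FiniteField.Carrier F) →
    IsBilinear F d B → IsNonDegenerate F d B →
    (𝒜 ℬ 𝒞 : Pred (Vector F d) 0ℓ) →
    (𝒜? : Decidable 𝒜) (ℬ? : Decidable ℬ) (𝒞? : Decidable 𝒞) →
    C * fromℕ (q ^ (d +ⁿ 2)) ≤ fromℕ (card F d 𝒜? *ⁿ card F d ℬ?) →
    C * fromℕ (q ^ (d +ⁿ 2)) ≤ fromℕ (card F d 𝒜? *ⁿ card F d 𝒞?) →
    C * fromℕ (q ^ (d +ⁿ 2)) ≤ fromℕ (card F d ℬ? *ⁿ card F d 𝒞?) →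
    (1ℚ - ε) * fromℕ (q ^ 3) ≤ fromℕ (#solvable F d B 𝒜? ℬ? 𝒞?))
theorem1p4 d@(ℕ.suc _) (s≤s _) ε 0<ε =
  fromℕ (K ^ d) , fromℕ-positive (K ^ d) {{m^n≢0 K d}} ,
  λ q _ F B bil nd 𝒜 ℬ 𝒞 𝒜? ℬ? 𝒞? 𝒜ℬ 𝒜𝒞 ℬ𝒞 →
    let dense = fromℕ-*-cancel-≤ (K ^ d) (q ^ (d +ⁿ 2))
    in 1-ε-bound 0<ε (q ^ 3) (#solvable F d B 𝒜? ℬ? 𝒞?)
         (#solvable-≥ F d B bil nd 𝒜? ℬ? 𝒞? K (m≤m*n 9 (↧ₙ ε))
           (dense (card F d 𝒜? *ⁿ card F d ℬ?) 𝒜ℬ)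
           (dense (card F d 𝒜? *ⁿ card F d 𝒞?) 𝒜𝒞)
           (dense (card F d ℬ? *ⁿ card F d 𝒞?) ℬ𝒞))
  where
  -- The factor 9 ensures both 9 ≤ `K`, as the choice of a balanced point demands, and 7 / `K` <
  -- `ε`.
  K : ℕ
  K = 9 *ⁿ ↧ₙ ε
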